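{- Let $E(x)=\left(1-\frac1{x^2}\right)^{ -1}$ and, for each positive integer $n$, let $$A_n=\begin{pmatrix}\displaystyle\prod_{p\mid 2n+1}E(p) & E(2n+1)\\ E(2n+3)&\displaystyle\prod_{p\mid 2n+3}E(p)\end{pmatrix},$$ where the products are taken over prime divisors $p$, and let $|A_n|$ be the determinant of $A_n$. Let $s>2$ be a real number. Then there is a positive constant $\tau(s)$, depending on $s$, such that the series $$\omega(s)=\sum_{n=1}^{\infty}\frac{1}{1+|A_n|\,n^s}$$ converges if and only if there are finitely many pairs of twin primes, and, if the number of pairs of twin primes is a finite number $N$, then the series converges to $N+\tau(s)$.
   Context: A pair of twin primes is a pair $(p,p+2)$ with both $p$ and $p+2$ prime. -}

module Defs where

open import Algebra.Bundles using (CommutativeRing)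
open import Data.Empty using (⊥; ⊥-elim)
open import Data.Integer.Base using (ℤ; +_; -[1+_])
open import Data.Nat.Base using (ℕ; zero; suc)
open import Data.List.Base as List using (List; []; _∷_)
open import Data.List.Membership.Propositional using (_∈_)
open import Data.List.Membership.Propositional.Properties using (∈-filter⁺; ∈-filter⁻; ∈-upTo⁺)
open import Data.List.Relation.Unary.All using (All; []; _∷_)
open import Data.List.Relation.Unary.Any using (here; there)
open import Data.List.Relation.Unary.Unique.Propositional using (Unique)
open import Data.Nat.Divisibility using (_∣_; _∣?_; ∣⇒≤; ∣m⇒∣m*n; ∣-refl)
open import Data.Nat.ListAction using (product)
open import Data.Nat.Primality using (Prime; prime?)
open import Data.Nat.Primality.Factorisation using (PrimeFactorisation; factorise)
open import Data.Product.Base using (∃; ∃₂; _×_; _,_; proj₁; proj₂)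
open import Data.Rational.Base
open import Data.Rational.Properties
open import Data.Rational.Solver using (module +-*-Solver)
open import Data.Sum.Base using (_⊎_; inj₁; inj₂)
open import Relation.Binary.Definitions using (tri<; tri≈; tri>)
open import Relation.Binary.PropositionalEquality
  using (_≡_; refl; sym; trans; cong; cong₂; subst; subst₂)
open import Data.Vec.Base as Vec using (Vec)
open import Function.Bundles using (_⇔_)
open import Relation.Nullary using (Dec; yes; no)
open import Relation.Nullary.Decidable using (_×-dec_; toWitness)

import Data.Integer as ℤ
import Data.Integer.Properties as ℤ
import Data.Nat as ℕ
import Data.Nat.Properties as ℕ
import Data.Rational.Unnormalised.Base as ℚᵘ
import Data.Rational.Unnormalised.Properties as ℚᵘ

open import Algebra.Properties.Semiring.Exp (CommutativeRing.semiring +-*-commutativeRing)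
  using (_^_; ^-homo-*; ^-assocʳ)

fromℕ : ℕ → ℚ
fromℕ n = + n / 1

-- Total reciprocal; the value at 0 is never used.
infix 9 _⁻¹
_⁻¹ : ℚ → ℚ
q ⁻¹ with q ≟ 0ℚ
... | yes _   = 0ℚ
... | no  q≢0 = (1/ q) {{≢-nonZero q≢0}}

infixr 8 _^ℤ_
_^ℤ_ : ℚ → ℤ → ℚ
q ^ℤ (+ n)    = q ^ n
q ^ℤ -[1+ n ] = (q ^ suc n) ⁻¹

lin< : ∀ {u v x y} → u < v → x + v ≡ y + u → x < y
lin< {u} {v} {x} {y} u<v e with x <? y
... | yes x<y = x<y
... | no  x≮y = ⊥-elim (<-irrefl (sym e) (+-mono-≤-< (≮⇒≥ x≮y) u<v))

lin≤ : ∀ {u v x y} → u ≤ v → x + v ≡ y + u → x ≤ y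
lin≤ {u} {v} {x} {y} u≤v e with x ≤? y
... | yes x≤y = x≤y
... | no  x≰y = ⊥-elim (<-irrefl (sym e) (+-mono-<-≤ (≰⇒> x≰y) u≤v))

below : ∀ p → ∃ λ q → q < p
below p = p - 1ℚ , lin< {0ℚ} {1ℚ} (positive⁻¹ 1ℚ)
  (solve 1 (λ p → p :- con 1ℚ :+ con 1ℚ := p :+ con 0ℚ) refl p)
  where open +-*-Solver

above : ∀ p → ∃ λ q → p < q
above p = p + 1ℚ , lin< {0ℚ} {1ℚ} (positive⁻¹ 1ℚ)
  (solve 1 (λ p → p :+ con 1ℚ := p :+ con 1ℚ :+ con 0ℚ) refl p)
  where open +-*-Solver

0<1 : 0ℚ < 1ℚ
0<1 = positive⁻¹ 1ℚ

0<½ : 0ℚ < ½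
0<½ = positive⁻¹ ½

*-pos : ∀ {x y} → 0ℚ < x → 0ℚ < y → 0ℚ < x * y
*-pos {x} {y} 0<x 0<y =
  positive⁻¹ (x * y) {{pos*pos⇒pos x {{positive 0<x}} y {{positive 0<y}}}}

*-nonNeg : ∀ {x y} → 0ℚ ≤ x → 0ℚ ≤ y → 0ℚ ≤ x * y
*-nonNeg {x} {y} 0≤x 0≤y =
  nonNegative⁻¹ (x * y) {{nonNeg*nonNeg⇒nonNeg x {{nonNegative 0≤x}} y {{nonNegative 0≤y}}}}

*-mono-≤ : ∀ {a b c d} → 0ℚ ≤ a → 0ℚ ≤ d → a ≤ b → c ≤ d → a * c ≤ b * d
*-mono-≤ {a} {b} {c} {d} 0≤a 0≤d a≤b c≤d =
  ≤-trans (*-monoˡ-≤-nonNeg a {{nonNegative 0≤a}} c≤d)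
          (*-monoʳ-≤-nonNeg d {{nonNegative 0≤d}} a≤b)

*-mono-< : ∀ {a b c d} → 0ℚ ≤ a → 0ℚ < d → a < b → c ≤ d → a * c < b * d
*-mono-< {a} {b} {c} {d} 0≤a 0<d a<b c≤d =
  ≤-<-trans (*-monoˡ-≤-nonNeg a {{nonNegative 0≤a}} c≤d)
            (*-monoˡ-<-pos d {{positive 0<d}} a<b)

⁻¹-inverseʳ : ∀ {q} → 0ℚ < q → q * q ⁻¹ ≡ 1ℚ
⁻¹-inverseʳ {q} 0<q with q ≟ 0ℚ
... | yes refl = ⊥-elim (<-irrefl refl 0<q)
... | no  q≢0  = *-inverseʳ q {{≢-nonZero q≢0}}

⁻¹-pos : ∀ {q} → 0ℚ < q → 0ℚ < q ⁻¹
⁻¹-pos {q} 0<q with 0ℚ <? q ⁻¹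
... | yes p = p
... | no ¬p = ⊥-elim (<-irrefl refl (<-≤-trans 0<1 (subst₂ _≤_ (⁻¹-inverseʳ 0<q) (*-zeroʳ q)
                (*-monoˡ-≤-nonNeg q {{nonNegative (<⇒≤ 0<q)}} (≮⇒≥ ¬p)))))

⁻¹-unique : ∀ {q r} → 0ℚ < q → q * r ≡ 1ℚ → r ≡ q ⁻¹
⁻¹-unique {q} {r} 0<q e =
  trans (sym (*-identityʳ r)) (trans (cong (r *_) (sym (⁻¹-inverseʳ 0<q)))
  (trans (solve 3 (λ r q i → r :* (q :* i) := (q :* r) :* i) refl r q (q ⁻¹))
  (trans (cong (_* q ⁻¹) e) (*-identityˡ (q ⁻¹)))))
  where open +-*-Solver

⁻¹-anti-≤ : ∀ {p q} → 0ℚ < p → p ≤ q → q ⁻¹ ≤ p ⁻¹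
⁻¹-anti-≤ {p} {q} 0<p p≤q =
  *-cancelˡ-≤-pos p {{positive 0<p}}
    (subst (p * q ⁻¹ ≤_) (trans (⁻¹-inverseʳ 0<q) (sym (⁻¹-inverseʳ 0<p)))
      (*-monoʳ-≤-nonNeg (q ⁻¹) {{nonNegative (<⇒≤ (⁻¹-pos 0<q))}} p≤q))
  where 0<q = <-≤-trans 0<p p≤q

≤∣∣ : ∀ p → p ≤ ∣ p ∣
≤∣∣ p with ∣p∣≡p∨∣p∣≡-p p
... | inj₁ e = ≤-reflexive (sym e)
... | inj₂ e = ≤-trans (lin≤ (subst (0ℚ ≤_) e (0≤∣p∣ p)) (+-inverseʳ p)) (0≤∣p∣ p)

fromℕ-suc : ∀ n → fromℕ (suc n) ≡ 1ℚ + fromℕ n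
fromℕ-suc n = toℚᵘ-injective
  (ℚᵘ.≃-trans (toℚᵘ-fromℚᵘ (ℚᵘ.mkℚᵘ (+ suc n) 0))
  (ℚᵘ.≃-trans (ℚᵘ.*≡* eq)
  (ℚᵘ.≃-sym (ℚᵘ.≃-trans (toℚᵘ-homo-+ 1ℚ (fromℕ n))
    (ℚᵘ.+-congʳ (toℚᵘ 1ℚ) (toℚᵘ-fromℚᵘ (ℚᵘ.mkℚᵘ (+ n) 0)))))))
  where
  eq : + suc n ℤ.* + 1 ≡ (+ 1 ℤ.* + 1 ℤ.+ + n ℤ.* + 1) ℤ.* + 1
  eq = cong (ℤ._* + 1) (cong (λ z → + 1 ℤ.+ z) (sym (ℤ.*-identityʳ (+ n))))

0≤fromℕ : ∀ n → 0ℚ ≤ fromℕ n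
0≤fromℕ n = nonNegative⁻¹ (fromℕ n) {{normalize-nonNeg n 1}}

fromℕ-mono-≤ : ∀ {m n} → m ℕ.≤ n → fromℕ m ≤ fromℕ n
fromℕ-mono-≤ {n = n} ℕ.z≤n = 0≤fromℕ n
fromℕ-mono-≤ {suc m} {suc n} (ℕ.s≤s m≤n) =
  subst₂ _≤_ (sym (fromℕ-suc m)) (sym (fromℕ-suc n)) (+-monoʳ-≤ 1ℚ (fromℕ-mono-≤ m≤n))

≤fromℕ : ∀ q → ∃ λ n → q ≤ fromℕ n
≤fromℕ q@(mkℚ a d _) = ℤ.∣ a ∣ , toℚᵘ-cancel-≤
  (ℚᵘ.≤-trans (ℚᵘ.*≤* le) (ℚᵘ.≤-reflexive (ℚᵘ.≃-sym (toℚᵘ-fromℚᵘ (ℚᵘ.mkℚᵘ (+ ℤ.∣ a ∣) 0)))))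
  where
  i≤∣i∣ : ∀ i → i ℤ.≤ + ℤ.∣ i ∣
  i≤∣i∣ (+ n)    = ℤ.≤-refl
  i≤∣i∣ -[1+ n ] = ℤ.-≤+
  le : a ℤ.* + 1 ℤ.≤ + ℤ.∣ a ∣ ℤ.* + suc d
  le = ℤ.≤-trans (ℤ.≤-reflexive (ℤ.*-identityʳ a)) (ℤ.≤-trans (i≤∣i∣ a)
         (subst (+ ℤ.∣ a ∣ ℤ.≤_) (ℤ.pos-* ℤ.∣ a ∣ (suc d)) (ℤ.+≤+ (ℕ.m≤m*n ℤ.∣ a ∣ (suc d)))))

archimedean : ∀ {ε} → 0ℚ < ε → ∀ q → ∃ λ n → q ≤ fromℕ n * ε
archimedean {ε} 0<ε q with ≤fromℕ (q * ε ⁻¹)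
... | n , le = n , subst (_≤ fromℕ n * ε) eq (*-monoʳ-≤-nonNeg ε {{nonNegative (<⇒≤ 0<ε)}} le)
  where
  open +-*-Solver
  eq : q * ε ⁻¹ * ε ≡ q
  eq = trans (solve 3 (λ q i ε → q :* i :* ε := q :* (ε :* i)) refl q (ε ⁻¹) ε)
       (trans (cong (q *_) (⁻¹-inverseʳ 0<ε)) (*-identityʳ q))

^-pos : ∀ {x} → 0ℚ < x → ∀ n → 0ℚ < x ^ n
^-pos 0<x zero    = 0<1
^-pos 0<x (suc n) = *-pos 0<x (^-pos 0<x n)

^-mono-≤ : ∀ {x y} → 0ℚ < x → x ≤ y → ∀ n → x ^ n ≤ y ^ n
^-mono-≤ 0<x x≤y zero    = ≤-refl
^-mono-≤ 0<x x≤y (suc n) =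
  *-mono-≤ (<⇒≤ 0<x) (<⇒≤ (^-pos (<-≤-trans 0<x x≤y) n)) x≤y (^-mono-≤ 0<x x≤y n)

^-mono-< : ∀ {x y} → 0ℚ < x → x < y → ∀ n .{{_ : ℕ.NonZero n}} → x ^ n < y ^ n
^-mono-< 0<x x<y (suc n) =
  *-mono-< (<⇒≤ 0<x) (^-pos (<-trans 0<x x<y) n) x<y (^-mono-≤ 0<x (<⇒≤ x<y) n)

^-cancel-≤ : ∀ {x y} → 0ℚ < y → ∀ n .{{_ : ℕ.NonZero n}} → x ^ n ≤ y ^ n → x ≤ y
^-cancel-≤ {x} {y} 0<y n le with x ≤? y
... | yes x≤y = x≤y
... | no  x≰y = ⊥-elim (<-irrefl refl (<-≤-trans (^-mono-< 0<y (≰⇒> x≰y) n) le))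

1≤^ : ∀ {x} → 1ℚ ≤ x → ∀ n → 1ℚ ≤ x ^ n
1≤^ 1≤x zero    = ≤-refl
1≤^ 1≤x (suc n) = *-mono-≤ (<⇒≤ 0<1) (<⇒≤ (^-pos (<-≤-trans 0<1 1≤x) n)) 1≤x (1≤^ 1≤x n)

^-distrib-* : ∀ x y n → (x * y) ^ n ≡ x ^ n * y ^ n
^-distrib-* x y zero    = refl
^-distrib-* x y (suc n) = trans (cong (x * y *_) (^-distrib-* x y n))
  (solve 4 (λ x y a b → x :* y :* (a :* b) := (x :* a) :* (y :* b)) refl x y (x ^ n) (y ^ n))
  where open +-*-Solver

1^ : ∀ n → 1ℚ ^ n ≡ 1ℚ
1^ zero    = refl
1^ (suc n) = trans (*-identityˡ (1ℚ ^ n)) (1^ n)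

⁻¹-^ : ∀ {x} → 0ℚ < x → ∀ n → (x ⁻¹) ^ n ≡ (x ^ n) ⁻¹
⁻¹-^ {x} 0<x n = ⁻¹-unique (^-pos 0<x n)
  (trans (sym (^-distrib-* x (x ⁻¹) n)) (trans (cong (_^ n) (⁻¹-inverseʳ 0<x)) (1^ n)))

^ℤ-pos : ∀ {x} → 0ℚ < x → ∀ i → 0ℚ < x ^ℤ i
^ℤ-pos 0<x (+ n)    = ^-pos 0<x n
^ℤ-pos 0<x -[1+ n ] = ⁻¹-pos (^-pos 0<x (suc n))

^ℤ-suc : ∀ {x} → 0ℚ < x → ∀ i → x ^ℤ (ℤ.suc i) ≡ x * x ^ℤ i
^ℤ-suc 0<x (+ n) = refl
^ℤ-suc {x} 0<x -[1+ zero ] =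
  sym (trans (cong (λ z → x * z ⁻¹) (*-identityʳ x)) (⁻¹-inverseʳ 0<x))
^ℤ-suc {x} 0<x -[1+ suc n ] = sym (⁻¹-unique (^-pos 0<x (suc n))
  (trans (solve 3 (λ x a b → a :* (x :* b) := x :* a :* b) refl x (x ^ suc n) ((x ^ suc (suc n)) ⁻¹))
         (⁻¹-inverseʳ (^-pos 0<x (suc (suc n))))))
  where open +-*-Solver

^ℤ-+ : ∀ {x} → 0ℚ < x → ∀ i n → x ^ℤ (+ n ℤ.+ i) ≡ x ^ n * x ^ℤ i
^ℤ-+ {x} 0<x i zero = trans (cong (x ^ℤ_) (ℤ.+-identityˡ i)) (sym (*-identityˡ _))
^ℤ-+ {x} 0<x i (suc n) =
  trans (cong (x ^ℤ_) (ℤ.+-assoc (+ 1) (+ n) i))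
  (trans (^ℤ-suc 0<x (+ n ℤ.+ i))
  (trans (cong (x *_) (^ℤ-+ 0<x i n)) (sym (*-assoc x (x ^ n) (x ^ℤ i)))))

^ℤ-mono : ∀ {x} → 1ℚ ≤ x → ∀ {i j} → i ℤ.≤ j → x ^ℤ i ≤ x ^ℤ j
^ℤ-mono {x} 1≤x {i} {j} i≤j with ℤ.∣ j ℤ.- i ∣ | ℤ.0≤i⇒+∣i∣≡i (ℤ.i≤j⇒0≤j-i i≤j)
... | n | e = subst₂ _≤_ (*-identityˡ _) eq
    (*-monoʳ-≤-nonNeg (x ^ℤ i) {{nonNegative (<⇒≤ (^ℤ-pos 0<x i))}} (1≤^ 1≤x n))
  where
  0<x = <-≤-trans 0<1 1≤x
  eq : x ^ n * x ^ℤ i ≡ x ^ℤ j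
  eq = trans (sym (^ℤ-+ 0<x i n)) (cong (x ^ℤ_) (trans (cong (ℤ._+ i) e) (trans (ℤ.+-assoc j (ℤ.- i) i) (trans (cong (λ t → j ℤ.+ t) (ℤ.+-inverseˡ i)) (ℤ.+-identityʳ j)))))

^ℤ-assoc : ∀ {x} → 0ℚ < x → ∀ i n → (x ^ℤ i) ^ n ≡ x ^ℤ (i ℤ.* + n)
^ℤ-assoc {x} 0<x (+ m)    n = trans (^-assocʳ x m n) (cong (x ^ℤ_) (ℤ.pos-* m n))
^ℤ-assoc {x} 0<x -[1+ m ] zero = cong (x ^ℤ_) (sym (ℤ.*-zeroʳ -[1+ m ]))
^ℤ-assoc {x} 0<x -[1+ m ] (suc n) =
  trans (⁻¹-^ (^-pos 0<x (suc m)) (suc n)) (cong _⁻¹ (^-assocʳ x (suc m) (suc n)))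

bernoulli : ∀ {δ} → 0ℚ < δ → ∀ n → 1ℚ + fromℕ n * δ ≤ (1ℚ + δ) ^ n
bernoulli {δ} 0<δ zero = ≤-reflexive (trans (cong (λ t → 1ℚ + t) (*-zeroˡ δ)) (+-identityʳ 1ℚ))
bernoulli {δ} 0<δ (suc n) = ≤-trans
    (lin≤ {0ℚ} {fromℕ n * δ * δ} (*-nonNeg (*-nonNeg (0≤fromℕ n) (<⇒≤ 0<δ)) (<⇒≤ 0<δ))
      (trans (cong (λ t → 1ℚ + t * δ + fromℕ n * δ * δ) (fromℕ-suc n))
        (solve 2 (λ n δ → con 1ℚ :+ (con 1ℚ :+ n) :* δ :+ n :* δ :* δ
            := (con 1ℚ :+ δ) :* (con 1ℚ :+ n :* δ) :+ con 0ℚ) refl (fromℕ n) δ)))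
    (*-monoˡ-≤-nonNeg (1ℚ + δ) {{nonNegative 0≤1+δ}} (bernoulli 0<δ n))
  where
  open +-*-Solver
  0≤1+δ : 0ℚ ≤ 1ℚ + δ
  0≤1+δ = subst (_≤ 1ℚ + δ) (+-identityˡ 0ℚ) (+-mono-≤ (<⇒≤ 0<1) (<⇒≤ 0<δ))

powers-unbounded : ∀ {y z} → 0ℚ < y → y < z → ∀ q →
                   ∃ λ m → q * y ^ suc m ≤ z ^ suc m
powers-unbounded {y} {z} 0<y y<z q = m , subst (q * y ^ suc m ≤_) eq
    (*-monoʳ-≤-nonNeg (y ^ suc m) {{nonNegative (<⇒≤ (^-pos 0<y (suc m)))}}
      (≤-trans (proj₂ arch) (≤-trans (lin≤ {0ℚ} {1ℚ + δ}
          (<⇒≤ (+-mono-< 0<1 0<δ))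
          (trans (solve 2 (λ n δ → n :* δ :+ (con 1ℚ :+ δ) := con 1ℚ :+ (con 1ℚ :+ n) :* δ :+ con 0ℚ)
                   refl (fromℕ m) δ)
                 (cong (λ t → 1ℚ + t * δ + 0ℚ) (sym (fromℕ-suc m)))))
        (bernoulli 0<δ (suc m)))))
  where
  open +-*-Solver
  δ = (z - y) * y ⁻¹
  0<z-y : 0ℚ < z - y
  0<z-y = lin< y<z (solve 2 (λ y z → con 0ℚ :+ z := z :- y :+ y) refl y z)
  0<δ = *-pos 0<z-y (⁻¹-pos 0<y)
  arch = archimedean 0<δ q
  m = proj₁ arch
  eq : (1ℚ + δ) ^ suc m * y ^ suc m ≡ z ^ suc m
  eq = trans (sym (^-distrib-* (1ℚ + δ) y (suc m))) (cong (_^ suc m)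
    (trans (solve 3 (λ y z i → (con 1ℚ :+ (z :- y) :* i) :* y := y :+ (z :- y) :* (y :* i)) refl y z (y ⁻¹))
    (trans (cong (λ t → y + (z - y) * t) (⁻¹-inverseʳ 0<y))
      (solve 2 (λ y z → y :+ (z :- y) :* con 1ℚ := z) refl y z))))

-- A real number is a located two-sided Dedekind cut: L holds the rationals strictly
-- below it, U those strictly above.

record ℝ : Set₁ where
  field
    L U         : ℚ → Set
    L-inhabited : ∃ L
    U-inhabited : ∃ U
    L-lower     : ∀ {p q} → p < q → L q → L p
    U-upper     : ∀ {p q} → p < q → U p → U q
    L-open      : ∀ {p} → L p → ∃ λ q → p < q × L q
    U-open      : ∀ {q} → U q → ∃ λ p → p < q × U p
    disjoint    : ∀ {q} → L q → U q → ⊥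
    located     : ∀ {p q} → p < q → L p ⊎ U q

open ℝ

infix 4 _<ᴿ_
_<ᴿ_ : ℝ → ℝ → Set
x <ᴿ y = ∃ λ q → U x q × L y q

fromℚ : ℚ → ℝ
fromℚ p .L q         = q < p
fromℚ p .U q         = p < q
fromℚ p .L-inhabited = below p
fromℚ p .U-inhabited = above p
fromℚ p .L-lower     = <-trans
fromℚ p .U-upper q<r p<q = <-trans p<q q<r
fromℚ p .L-open q<p =
  let r , q<r , r<p = <-dense q<p in r , q<r , r<p
fromℚ p .U-open p<q =
  let r , p<r , r<q = <-dense p<q in r , r<q , p<r
fromℚ p .disjoint q<p p<q = <-asym q<p p<q
fromℚ p .located {q} {r} q<r with q <? p
... | yes q<p = inj₁ q<p
... | no  q≮p = inj₂ (≤-<-trans (≮⇒≥ q≮p) q<r)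

0ᴿ 1ᴿ : ℝ
0ᴿ = fromℚ 0ℚ
1ᴿ = fromℚ 1ℚ

L<U : ∀ x {p q} → L x p → U x q → p < q
L<U x {p} {q} Lp Uq with <-cmp p q
... | tri< p<q _ _  = p<q
... | tri≈ _ refl _ = ⊥-elim (disjoint x Lp Uq)
... | tri> _ _ q<p  = ⊥-elim (disjoint x (L-lower x q<p Lp) Uq)

half-step : ∀ a {ε} → 0ℚ < ε → a + ε * ½ < a + ε
half-step a {ε} 0<ε = lin< (*-pos 0<ε 0<½)
  (solve 2 (λ a ε → a :+ ε :* con ½ :+ ε :* con ½ := a :+ ε :+ con 0ℚ) refl a ε)
  where open +-*-Solver

walk : ∀ x {ε} → 0ℚ < ε → ∀ k a → L x a → U x (a + fromℕ k * (ε * ½)) →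
       ∃ λ a → L x a × U x (a + ε)
walk x {ε} 0<ε zero a La Ua = ⊥-elim (disjoint x La
  (subst (U x) (trans (cong (λ t → a + t) (*-zeroˡ (ε * ½))) (+-identityʳ a)) Ua))
walk x {ε} 0<ε (suc k) a La Ua = go (located x (half-step a 0<ε))
  where
  open +-*-Solver
  go : L x (a + ε * ½) ⊎ U x (a + ε) → ∃ λ a → L x a × U x (a + ε)
  go (inj₂ Uε) = a , La , Uε
  go (inj₁ Lδ) = walk x 0<ε k (a + ε * ½) Lδ (subst (U x)
    (trans (cong (λ t → a + t * (ε * ½)) (fromℕ-suc k))
      (solve 3 (λ a k δ → a :+ (con 1ℚ :+ k) :* δ := a :+ δ :+ k :* δ) refl a (fromℕ k) (ε * ½))) Ua)

x-y≤z⇒x≤y+z : ∀ {x y z} → x - y ≤ z → x ≤ y + z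
x-y≤z⇒x≤y+z {x} {y} {z} le = lin≤ le (solve 3 (λ x y z → x :+ z := y :+ z :+ (x :- y)) refl x y z)
  where open +-*-Solver

U-upper-≤ : ∀ x {p q} → p ≤ q → U x p → U x q
U-upper-≤ x p≤q Up with U-open x Up
... | _ , r<p , Ur = U-upper x (<-≤-trans r<p p≤q) Ur

approx : ∀ x {ε} → 0ℚ < ε → ∃ λ a → L x a × U x (a + ε)
approx x {ε} 0<ε = go (L-inhabited x) (U-inhabited x)
  where
  go : ∃ (L x) → ∃ (U x) → ∃ λ a → L x a × U x (a + ε)
  go (l , Ll) (u , Uu) = start (archimedean (*-pos 0<ε 0<½) (u - l))
    where
    start : (∃ λ k → u - l ≤ fromℕ k * (ε * ½)) → ∃ λ a → L x a × U x (a + ε)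
    start (k , le) = walk x 0<ε k l Ll (U-upper-≤ x (x-y≤z⇒x≤y+z le) Uu)

p<q⇒0<q-p : ∀ {p q} → p < q → 0ℚ < q - p
p<q⇒0<q-p {p} {q} p<q = lin< p<q (solve 2 (λ p q → con 0ℚ :+ q := q :- p :+ p) refl p q)
  where open +-*-Solver

¼ : ℚ
¼ = ½ * ½

quarter-pos : ∀ {p q} → p < q → 0ℚ < (q - p) * ¼
quarter-pos p<q = *-pos (p<q⇒0<q-p p<q) (*-pos 0<½ 0<½)

sum-upper : ∀ {p q} a b → p < q → a + b ≤ p → a + (q - p) * ¼ + (b + (q - p) * ¼) < q
sum-upper {p} {q} a b p<q a+b≤p =
  lin< (+-mono-≤-< a+b≤p (*-pos (p<q⇒0<q-p p<q) 0<½))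
    (solve 4 (λ a b p q → a :+ (q :- p) :* con ¼ :+ (b :+ (q :- p) :* con ¼)
                :+ (p :+ (q :- p) :* con ½) := q :+ (a :+ b :+ con 0ℚ)) refl a b p q)
  where open +-*-Solver

infixl 6 _+ᴿ_
_+ᴿ_ : ℝ → ℝ → ℝ
(x +ᴿ y) .L q = ∃₂ λ a b → L x a × L y b × q < a + b
(x +ᴿ y) .U q = ∃₂ λ a b → U x a × U y b × a + b < q
(x +ᴿ y) .L-inhabited =
  let a , La = L-inhabited x ; b , Lb = L-inhabited y ; q , q< = below (a + b)
  in q , a , b , La , Lb , q<
(x +ᴿ y) .U-inhabited =
  let a , Ua = U-inhabited x ; b , Ub = U-inhabited y ; q , <q = above (a + b)
  in q , a , b , Ua , Ub , <q
(x +ᴿ y) .L-lower p<q (a , b , La , Lb , q<) = a , b , La , Lb , <-trans p<q q<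
(x +ᴿ y) .U-upper p<q (a , b , Ua , Ub , <p) = a , b , Ua , Ub , <-trans <p p<q
(x +ᴿ y) .L-open (a , b , La , Lb , q<) =
  let r , q<r , r< = <-dense q< in r , q<r , a , b , La , Lb , r<
(x +ᴿ y) .U-open (a , b , Ua , Ub , <q) =
  let r , <r , r<q = <-dense <q in r , r<q , a , b , Ua , Ub , <r
(x +ᴿ y) .disjoint (a , b , La , Lb , q<) (c , d , Uc , Ud , <q) =
  <-asym (<-trans q< (+-mono-< (L<U x La Uc) (L<U y Lb Ud))) <q
(x +ᴿ y) .located {p} {q} p<q = go (approx x (quarter-pos p<q)) (approx y (quarter-pos p<q))
  where
  ε = (q - p) * ¼
  go : (∃ λ a → L x a × U x (a + ε)) → (∃ λ b → L y b × U y (b + ε)) → _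
  go (a , La , Ua) (b , Lb , Ub) with p <? a + b
  ... | yes p<a+b = inj₁ (a , b , La , Lb , p<a+b)
  ... | no  p≮a+b = inj₂ (a + ε , b + ε , Ua , Ub , sum-upper a b p<q (≮⇒≥ p≮a+b))

-- The least and greatest values of u * v over a ≤ u ≤ a′ and b ≤ v ≤ b′ are
-- attained at the corners of the rectangle.
min* max* : (a a′ b b′ : ℚ) → ℚ
min* a a′ b b′ = ((a * b) ⊓ (a * b′)) ⊓ ((a′ * b) ⊓ (a′ * b′))
max* a a′ b b′ = ((a * b) ⊔ (a * b′)) ⊔ ((a′ * b) ⊔ (a′ * b′))

min-edge : ∀ c {b b′ v} → b ≤ v → v ≤ b′ → (c * b) ⊓ (c * b′) ≤ c * v
min-edge c {b} {b′} b≤v v≤b′ with ≤-total 0ℚ c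
... | inj₁ 0≤c = ≤-trans (p⊓q≤p (c * b) (c * b′)) (*-monoˡ-≤-nonNeg c {{nonNegative 0≤c}} b≤v)
... | inj₂ c≤0 = ≤-trans (p⊓q≤q (c * b) (c * b′)) (*-monoˡ-≤-nonPos c {{nonPositive c≤0}} v≤b′)

max-edge : ∀ c {b b′ v} → b ≤ v → v ≤ b′ → c * v ≤ (c * b) ⊔ (c * b′)
max-edge c {b} {b′} b≤v v≤b′ with ≤-total 0ℚ c
... | inj₁ 0≤c = ≤-trans (*-monoˡ-≤-nonNeg c {{nonNegative 0≤c}} v≤b′) (p≤q⊔p (c * b) (c * b′))
... | inj₂ c≤0 = ≤-trans (*-monoˡ-≤-nonPos c {{nonPositive c≤0}} b≤v) (p≤p⊔q (c * b) (c * b′))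

min*≤ : ∀ {a a′ b b′ u v} → a ≤ u → u ≤ a′ → b ≤ v → v ≤ b′ → min* a a′ b b′ ≤ u * v
min*≤ {a} {a′} {u = u} {v} a≤u u≤a′ b≤v v≤b′ =
  ≤-trans (⊓-mono-≤ (min-edge a b≤v v≤b′) (min-edge a′ b≤v v≤b′))
    (subst₂ _≤_ (cong₂ _⊓_ (*-comm v a) (*-comm v a′)) (*-comm v u) (min-edge v a≤u u≤a′))

≤max* : ∀ {a a′ b b′ u v} → a ≤ u → u ≤ a′ → b ≤ v → v ≤ b′ → u * v ≤ max* a a′ b b′
≤max* {a} {a′} {u = u} {v} a≤u u≤a′ b≤v v≤b′ =
  ≤-trans (subst₂ _≤_ (*-comm v u) (cong₂ _⊔_ (*-comm v a) (*-comm v a′)) (max-edge v a≤u u≤a′))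
    (⊔-mono-≤ (max-edge a b≤v v≤b′) (max-edge a′ b≤v v≤b′))

common : ∀ x {a a′ c c′} → L x a → U x a′ → L x c → U x c′ →
         ∃ λ u → (a ≤ u × u ≤ a′) × (c ≤ u × u ≤ c′)
common x {a} {a′} {c} {c′} La Ua′ Lc Uc′ = a ⊔ c ,
  (p≤p⊔q a c , ⊔-lub (<⇒≤ (L<U x La Ua′)) (<⇒≤ (L<U x Lc Ua′))) ,
  (p≤q⊔p a c , ⊔-lub (<⇒≤ (L<U x La Uc′)) (<⇒≤ (L<U x Lc Uc′)))

small-mult : ∀ {a M ε} → 0ℚ < ε → - M ≤ a → a ≤ M → (- (ε * M) ≤ a * ε) × (a * ε ≤ ε * M)
small-mult {a} {M} {ε} 0<ε -M≤a a≤M =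
  subst (_≤ a * ε) (solve 2 (λ M ε → :- M :* ε := :- (ε :* M)) refl M ε)
    (*-monoʳ-≤-nonNeg ε {{nonNegative (<⇒≤ 0<ε)}} -M≤a) ,
  subst (a * ε ≤_) (*-comm M ε) (*-monoʳ-≤-nonNeg ε {{nonNegative (<⇒≤ 0<ε)}} a≤M)
  where open +-*-Solver

Bound : ℝ → Set
Bound x = ∃ λ M → 1ℚ ≤ M × (∀ {a ε} → 0ℚ < ε → ε ≤ 1ℚ → L x a → U x (a + ε) → - M ≤ a × a ≤ M)

bounded : ∀ x → Bound x
bounded x = M , 1≤M , bd
  where
  l = proj₁ (L-inhabited x)
  Ll = proj₂ (L-inhabited x)
  u = proj₁ (U-inhabited x)
  Uu = proj₂ (U-inhabited x)
  open +-*-Solver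
  M = 1ℚ + (∣ l ∣ + ∣ u ∣)
  1≤M : 1ℚ ≤ M
  1≤M = subst (_≤ M) (+-identityʳ 1ℚ)
    (+-monoʳ-≤ 1ℚ (subst (_≤ ∣ l ∣ + ∣ u ∣) (+-identityʳ 0ℚ) (+-mono-≤ (0≤∣p∣ l) (0≤∣p∣ u))))
  bd : ∀ {a ε} → 0ℚ < ε → ε ≤ 1ℚ → L x a → U x (a + ε) → - M ≤ a × a ≤ M
  bd {a} {ε} 0<ε ε≤1 La Ua =
    lin≤ (+-mono-≤ (+-mono-≤ (<⇒≤ (L<U x Ll Ua)) ε≤1)
                   (+-mono-≤ (subst (- l ≤_) (∣-p∣≡∣p∣ l) (≤∣∣ (- l))) (0≤∣p∣ u)))
      (solve 5 (λ a ε l ∣l∣ ∣u∣ → :- (con 1ℚ :+ (∣l∣ :+ ∣u∣)) :+ (a :+ ε :+ con 1ℚ :+ (∣l∣ :+ ∣u∣))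
          := a :+ (l :+ ε :+ (:- l :+ con 0ℚ))) refl a ε l ∣ l ∣ ∣ u ∣) ,
    ≤-trans (<⇒≤ (L<U x La Uu)) (lin≤ (+-mono-≤ (+-mono-≤ (≤∣∣ u) (0≤∣p∣ l)) (<⇒≤ 0<1))
      (solve 3 (λ u ∣l∣ ∣u∣ → u :+ (∣u∣ :+ ∣l∣ :+ con 1ℚ)
          := con 1ℚ :+ (∣l∣ :+ ∣u∣) :+ (u :+ con 0ℚ :+ con 0ℚ)) refl u ∣ l ∣ ∣ u ∣))

module Corners {a b A B ε} (0<ε : 0ℚ < ε) (ε≤1 : ε ≤ 1ℚ) (0≤A : 0ℚ ≤ A) (0≤B : 0ℚ ≤ B)
               (-A≤a : - A ≤ a) (a≤A : a ≤ A) (-B≤b : - B ≤ b) (b≤B : b ≤ B) where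
  open +-*-Solver
  η = ε * (A + B + 1ℚ)
  sa = small-mult 0<ε -A≤a a≤A
  sb = small-mult 0<ε -B≤b b≤B
  0≤εε = *-nonNeg (<⇒≤ 0<ε) (<⇒≤ 0<ε)
  εε≤ε : ε * ε ≤ ε * 1ℚ
  εε≤ε = *-monoˡ-≤-nonNeg ε {{nonNegative (<⇒≤ 0<ε)}} ε≤1
  0≤εA = *-nonNeg (<⇒≤ 0<ε) 0≤A
  0≤εB = *-nonNeg (<⇒≤ 0<ε) 0≤B
  0≤ε1 = *-nonNeg (<⇒≤ 0<ε) (<⇒≤ 0<1)

  near : ∀ {s t u : ℚ} {c} → c ≡ a * b + (s + t + u) →
         (- (ε * A) ≤ s × s ≤ ε * A) → (- (ε * B) ≤ t × t ≤ ε * B) → (- (ε * 1ℚ) ≤ u × u ≤ ε * 1ℚ) →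
         (a * b - η ≤ c) × (c ≤ a * b + η)
  near {s} {t} {u} refl (s₁ , s₂) (t₁ , t₂) (u₁ , u₂) =
    lin≤ (+-mono-≤ (+-mono-≤ s₁ t₁) u₁)
      (solve 7 (λ ab ε A B s t u → ab :- ε :* (A :+ B :+ con 1ℚ) :+ (s :+ t :+ u)
        := ab :+ (s :+ t :+ u) :+ (:- (ε :* A) :+ :- (ε :* B) :+ :- (ε :* con 1ℚ))) refl (a * b) ε A B s t u) ,
    lin≤ (+-mono-≤ (+-mono-≤ s₂ t₂) u₂)
      (solve 7 (λ ab ε A B s t u → ab :+ (s :+ t :+ u) :+ (ε :* A :+ ε :* B :+ ε :* con 1ℚ)
        := ab :+ ε :* (A :+ B :+ con 1ℚ) :+ (s :+ t :+ u)) refl (a * b) ε A B s t u)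

  around0 : ∀ {t} → 0ℚ ≤ t → - t ≤ 0ℚ × 0ℚ ≤ t
  around0 {t} 0≤t = lin≤ 0≤t (trans (+-inverseˡ t) (sym (+-identityˡ 0ℚ))) , 0≤t

  below0 : ∀ {t u} → 0ℚ ≤ t → 0ℚ ≤ u → u ≤ t → - t ≤ u × u ≤ t
  below0 0≤t 0≤u u≤t = ≤-trans (proj₁ (around0 0≤t)) 0≤u , u≤t

  c₁ = near {0ℚ} {0ℚ} {0ℚ} (solve 2 (λ a b → a :* b := a :* b :+ (con 0ℚ :+ con 0ℚ :+ con 0ℚ)) refl a b)
         (around0 0≤εA) (around0 0≤εB) (around0 0≤ε1)
  c₂ = near {a * ε} {0ℚ} {0ℚ}
         (solve 3 (λ a b ε → a :* (b :+ ε) := a :* b :+ (a :* ε :+ con 0ℚ :+ con 0ℚ)) refl a b ε)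
         sa (around0 0≤εB) (around0 0≤ε1)
  c₃ = near {0ℚ} {b * ε} {0ℚ}
         (solve 3 (λ a b ε → (a :+ ε) :* b := a :* b :+ (con 0ℚ :+ b :* ε :+ con 0ℚ)) refl a b ε)
         (around0 0≤εA) sb (around0 0≤ε1)
  c₄ = near {a * ε} {b * ε} {ε * ε}
         (solve 3 (λ a b ε → (a :+ ε) :* (b :+ ε) := a :* b :+ (a :* ε :+ b :* ε :+ ε :* ε)) refl a b ε)
         sa sb (below0 0≤ε1 0≤εε εε≤ε)

  min-near : a * b - η ≤ min* a (a + ε) b (b + ε)
  min-near = ⊓-glb (⊓-glb (proj₁ c₁) (proj₁ c₂)) (⊓-glb (proj₁ c₃) (proj₁ c₄))
  max-near : max* a (a + ε) b (b + ε) ≤ a * b + η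
  max-near = ⊔-lub (⊔-lub (proj₂ c₁) (proj₂ c₂)) (⊔-lub (proj₂ c₃) (proj₂ c₄))

tolerance : ∀ {K t} → 0ℚ < K → 0ℚ < t → ∃ λ ε → 0ℚ < ε × ε ≤ 1ℚ × ε * K ≤ t
tolerance {K} {t} 0<K 0<t = (t * K ⁻¹) ⊓ 1ℚ , 0<ε , p⊓q≤q (t * K ⁻¹) 1ℚ ,
    ≤-trans (*-monoʳ-≤-nonNeg K {{nonNegative (<⇒≤ 0<K)}} (p⊓q≤p (t * K ⁻¹) 1ℚ)) (≤-reflexive eq)
  where
  open +-*-Solver
  0<ε : 0ℚ < (t * K ⁻¹) ⊓ 1ℚ
  0<ε with ⊓-sel (t * K ⁻¹) 1ℚ
  ... | inj₁ e = subst (0ℚ <_) (sym e) (*-pos 0<t (⁻¹-pos 0<K))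
  ... | inj₂ e = subst (0ℚ <_) (sym e) 0<1
  eq : t * K ⁻¹ * K ≡ t
  eq = trans (solve 3 (λ t i K → t :* i :* K := t :* (K :* i)) refl t (K ⁻¹) K)
         (trans (cong (t *_) (⁻¹-inverseʳ 0<K)) (*-identityʳ t))

product-upper : ∀ {p q η} c → p < q → c ≤ p + η → η ≤ (q - p) * ¼ → c + η < q
product-upper {p} {q} {η} c p<q c≤ η≤ =
  lin< (+-mono-≤-< (+-mono-≤ (+-mono-≤ c≤ η≤) η≤) (*-pos (p<q⇒0<q-p p<q) 0<½))
    (solve 4 (λ p q η c → c :+ η :+ (p :+ η :+ (q :- p) :* con ¼ :+ (q :- p) :* con ¼ :+ (q :- p) :* con ½)
       := q :+ (c :+ η :+ η :+ con 0ℚ)) refl p q η c)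
  where open +-*-Solver

product-lower : ∀ {p η c} → p + η < c → p < c - η
product-lower {p} {η} {c} p+η<c = lin< p+η<c (solve 3 (λ p η c → p :+ c := c :- η :+ (p :+ η)) refl p η c)
  where open +-*-Solver

-- x * y is bounded by the extreme corner products of rational enclosures of x and y,
-- which determines its cut because the enclosures can be made arbitrarily small.
infixl 7 _*ᴿ_
_*ᴿ_ : ℝ → ℝ → ℝ
(x *ᴿ y) .L q = ∃₂ λ a a′ → ∃₂ λ b b′ → (L x a × U x a′) × (L y b × U y b′) × q < min* a a′ b b′
(x *ᴿ y) .U q = ∃₂ λ a a′ → ∃₂ λ b b′ → (L x a × U x a′) × (L y b × U y b′) × max* a a′ b b′ < q
(x *ᴿ y) .L-inhabited =
  let a , La = L-inhabited x ; a′ , Ua′ = U-inhabited x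
      b , Lb = L-inhabited y ; b′ , Ub′ = U-inhabited y
      q , q< = below (min* a a′ b b′)
  in q , a , a′ , b , b′ , (La , Ua′) , (Lb , Ub′) , q<
(x *ᴿ y) .U-inhabited =
  let a , La = L-inhabited x ; a′ , Ua′ = U-inhabited x
      b , Lb = L-inhabited y ; b′ , Ub′ = U-inhabited y
      q , <q = above (max* a a′ b b′)
  in q , a , a′ , b , b′ , (La , Ua′) , (Lb , Ub′) , <q
(x *ᴿ y) .L-lower p<q (a , a′ , b , b′ , X , Y , q<) = a , a′ , b , b′ , X , Y , <-trans p<q q<
(x *ᴿ y) .U-upper p<q (a , a′ , b , b′ , X , Y , <p) = a , a′ , b , b′ , X , Y , <-trans <p p<q
(x *ᴿ y) .L-open (a , a′ , b , b′ , X , Y , q<) =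
  let r , q<r , r< = <-dense q< in r , q<r , a , a′ , b , b′ , X , Y , r<
(x *ᴿ y) .U-open (a , a′ , b , b′ , X , Y , <q) =
  let r , <r , r<q = <-dense <q in r , r<q , a , a′ , b , b′ , X , Y , <r
(x *ᴿ y) .disjoint (a , a′ , b , b′ , (La , Ua′) , (Lb , Ub′) , q<) (c , c′ , d , d′ , (Lc , Uc′) , (Ld , Ud′) , <q)
  with common x La Ua′ Lc Uc′ | common y Lb Ub′ Ld Ud′
... | u , (a≤u , u≤a′) , (c≤u , u≤c′) | v , (b≤v , v≤b′) , (d≤v , v≤d′) =
  <-asym (<-≤-trans q< (≤-trans (min*≤ a≤u u≤a′ b≤v v≤b′) (≤max* c≤u u≤c′ d≤v v≤d′))) <q
(x *ᴿ y) .located {p} {q} p<q = go (bounded x) (bounded y)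
  where
  go : Bound x → Bound y → (x *ᴿ y) .L p ⊎ (x *ᴿ y) .U q
  go (A , 1≤A , bx) (B , 1≤B , by) = choose (tolerance 0<K (quarter-pos p<q))
    where
    K = A + B + 1ℚ
    0≤A = ≤-trans (<⇒≤ 0<1) 1≤A
    0≤B = ≤-trans (<⇒≤ 0<1) 1≤B
    0<K : 0ℚ < K
    0<K = subst (_< K) (+-identityʳ 0ℚ) (+-mono-≤-< (+-mono-≤ 0≤A 0≤B) 0<1)
    choose : (∃ λ ε → 0ℚ < ε × ε ≤ 1ℚ × ε * K ≤ (q - p) * ¼) →
             (x *ᴿ y) .L p ⊎ (x *ᴿ y) .U q
    choose (ε , 0<ε , ε≤1 , η≤) = decide (approx x 0<ε) (approx y 0<ε)
      where
      decide : (∃ λ a → L x a × U x (a + ε)) → (∃ λ b → L y b × U y (b + ε)) →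
               (x *ᴿ y) .L p ⊎ (x *ᴿ y) .U q
      decide (a , La , Ua) (b , Lb , Ub) = compare (p + ε * K <? a * b)
        where
        boundsA = bx 0<ε ε≤1 La Ua
        boundsB = by 0<ε ε≤1 Lb Ub
        open Corners 0<ε ε≤1 0≤A 0≤B (proj₁ boundsA) (proj₂ boundsA) (proj₁ boundsB) (proj₂ boundsB)
        compare : Dec (p + ε * K < a * b) → (x *ᴿ y) .L p ⊎ (x *ᴿ y) .U q
        compare (yes lt) = inj₁ (a , a + ε , b , b + ε , (La , Ua) , (Lb , Ub) ,
                             <-≤-trans (product-lower lt) min-near)
        compare (no ¬lt) = inj₂ (a , a + ε , b , b + ε , (La , Ua) , (Lb , Ub) ,
                             ≤-<-trans max-near (product-upper (a * b) p<q (≮⇒≥ ¬lt) η≤))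

⁻¹-anti-< : ∀ {p q} → 0ℚ < p → p < q → q ⁻¹ < p ⁻¹
⁻¹-anti-< {p} {q} 0<p p<q =
  *-cancelˡ-<-nonNeg p {{nonNegative (<⇒≤ 0<p)}}
    (subst (p * q ⁻¹ <_) (trans (⁻¹-inverseʳ 0<q) (sym (⁻¹-inverseʳ 0<p)))
      (*-monoˡ-<-pos (q ⁻¹) {{positive (⁻¹-pos 0<q)}} p<q))
  where 0<q = <-trans 0<p p<q

*⁻¹* : ∀ t {r} → 0ℚ < r → t * r ⁻¹ * r ≡ t
*⁻¹* t {r} 0<r = trans (solve 3 (λ t i r → t :* i :* r := t :* (r :* i)) refl t (r ⁻¹) r)
                   (trans (cong (t *_) (⁻¹-inverseʳ 0<r)) (*-identityʳ t))
  where open +-*-Solver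

<-div : ∀ {q r t} → 0ℚ < r → q * r < t → q < t * r ⁻¹
<-div {q} {r} {t} 0<r lt = *-cancelʳ-<-nonNeg r {{nonNegative (<⇒≤ 0<r)}}
  (subst (q * r <_) (sym (*⁻¹* t 0<r)) lt)

>-div : ∀ {q r t} → 0ℚ < r → t < q * r → t * r ⁻¹ < q
>-div {q} {r} {t} 0<r lt = *-cancelʳ-<-nonNeg r {{nonNegative (<⇒≤ 0<r)}}
  (subst (_< q * r) (sym (*⁻¹* t 0<r)) lt)

nonPos-* : ∀ {p r} → p ≤ 0ℚ → 0ℚ < r → p * r ≤ 0ℚ
nonPos-* {p} {r} p≤0 0<r = subst (p * r ≤_) (*-zeroˡ r) (*-monoʳ-≤-nonNeg r {{nonNegative (<⇒≤ 0<r)}} p≤0)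

pos-factor : ∀ {q r} → 0ℚ < r → 1ℚ < q * r → 0ℚ < q
pos-factor 0<r 1<qr = ≰⇒> λ q≤0 → <-irrefl refl (<-≤-trans (<-trans 0<1 1<qr) (nonPos-* q≤0 0<r))

-- For x > 0: q < 1/x iff q * r < 1 for some rational r > x; 1/x < q iff 1 < q * r for
-- some rational 0 < r < x.
1/ᴿ : (x : ℝ) → 0ᴿ <ᴿ x → ℝ
1/ᴿ x 0<x = record
  { L = λ q → ∃ λ r → U x r × q * r < 1ℚ
  ; U = λ q → ∃ λ r → (L x r × 0ℚ < r) × 1ℚ < q * r
  ; L-inhabited = let u , Uu = U-inhabited x in
      0ℚ , u , Uu , subst (_< 1ℚ) (sym (*-zeroˡ u)) 0<1
  ; U-inhabited = let l , 0<l , Ll = 0<x ; t , 1<t = above 1ℚ in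
      t * l ⁻¹ , l , (Ll , 0<l) , subst (1ℚ <_) (sym (*⁻¹* t 0<l)) 1<t
  ; L-lower = λ { p<q (r , Ur , qr<1) →
      r , Ur , <-trans (*-monoˡ-<-pos r {{positive (U-pos Ur)}} p<q) qr<1 }
  ; U-upper = λ { p<q (r , (Lr , 0<r) , 1<pr) →
      r , (Lr , 0<r) , <-trans 1<pr (*-monoˡ-<-pos r {{positive 0<r}} p<q) }
  ; L-open = λ { (r , Ur , qr<1) → let t , qr<t , t<1 = <-dense qr<1 in
      t * r ⁻¹ , <-div (U-pos Ur) qr<t , r , Ur , subst (_< 1ℚ) (sym (*⁻¹* t (U-pos Ur))) t<1 }
  ; U-open = λ { (r , (Lr , 0<r) , 1<qr) → let t , 1<t , t<qr = <-dense 1<qr in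
      t * r ⁻¹ , >-div 0<r t<qr , r , (Lr , 0<r) , subst (1ℚ <_) (sym (*⁻¹* t 0<r)) 1<t }
  ; disjoint = λ { {q} (r , Ur , qr<1) (r′ , (Lr′ , 0<r′) , 1<qr′) →
      <-asym 1<qr′ (<-trans (*-monoʳ-<-pos q {{positive (pos-factor {q} 0<r′ 1<qr′)}} (L<U x Lr′ Ur)) qr<1) }
  ; located = loc
  }
  where
  U-pos : ∀ {r} → U x r → 0ℚ < r
  U-pos Ur = let l , 0<l , Ll = 0<x in <-trans 0<l (L<U x Ll Ur)
  loc : ∀ {p q} → p < q → (∃ λ r → U x r × p * r < 1ℚ) ⊎ (∃ λ r → (L x r × 0ℚ < r) × 1ℚ < q * r)
  loc {p} {q} p<q = split (0ℚ <? p)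
    where
    split : Dec (0ℚ < p) → _
    split (no  0≮p) = let u , Uu = U-inhabited x in
      inj₁ (u , Uu , ≤-<-trans (nonPos-* (≮⇒≥ 0≮p) (U-pos Uu)) 0<1)
    split (yes 0<p) = choose (located x a<b)
      where
      0<q = <-trans 0<p p<q
      d₁ = <-dense (⁻¹-anti-< 0<p p<q)
      a = proj₁ d₁
      q⁻¹<a = proj₁ (proj₂ d₁)
      d₂ = <-dense (proj₂ (proj₂ d₁))
      b = proj₁ d₂
      a<b = proj₁ (proj₂ d₂)
      b<p⁻¹ = proj₂ (proj₂ d₂)
      choose : L x a ⊎ U x b → _
      choose (inj₁ La) = inj₂ (a , (La , <-trans (⁻¹-pos 0<q) q⁻¹<a) ,
        subst (_< q * a) (⁻¹-inverseʳ 0<q) (*-monoʳ-<-pos q {{positive 0<q}} q⁻¹<a))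
      choose (inj₂ Ub) = inj₁ (b , Ub ,
        subst (p * b <_) (⁻¹-inverseʳ 0<p) (*-monoʳ-<-pos p {{positive 0<p}} b<p⁻¹))

1≤fromℕ : ∀ n .{{_ : ℕ.NonZero n}} → 1ℚ ≤ fromℕ n
1≤fromℕ (suc n) = fromℕ-mono-≤ (ℕ.s≤s (ℕ.z≤n {n}))

-- For a rational exponent r = a / d in lowest terms and y > 0, y ≤ n ^ r means
-- y ^ d ≤ n ^ a, and similarly for ≥.
BelowPow AbovePow : ℕ → ℚ → ℚ → Set
BelowPow n r y = 0ℚ < y × y ^ (↧ₙ r) ≤ fromℕ n ^ℤ (↥ r)
AbovePow n r y = 0ℚ < y × fromℕ n ^ℤ (↥ r) ≤ y ^ (↧ₙ r)

^-suc-≤ : ∀ {y} → 0ℚ < y → y ≤ 1ℚ → ∀ k → y ^ suc k ≤ y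
^-suc-≤ {y} 0<y y≤1 k = subst (y ^ suc k ≤_) (*-identityʳ y)
  (*-monoˡ-≤-nonNeg y {{nonNegative (<⇒≤ 0<y)}}
    (subst (y ^ k ≤_) (1^ k) (^-mono-≤ 0<y y≤1 k)))

≤-^-suc : ∀ {y} → 1ℚ ≤ y → ∀ k → y ≤ y ^ suc k
≤-^-suc {y} 1≤y k = subst (_≤ y ^ suc k) (*-identityʳ y)
  (*-monoˡ-≤-nonNeg y {{nonNegative (≤-trans (<⇒≤ 0<1) 1≤y)}} (1≤^ 1≤y k))

below-pow : ∀ n .{{_ : ℕ.NonZero n}} r → ∃ (BelowPow n r)
below-pow n r@(mkℚ _ d _) = 1ℚ ⊓ z , 0<y , ≤-trans (^-suc-≤ 0<y (p⊓q≤p 1ℚ z) d) (p⊓q≤q 1ℚ z)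
  where
  z = fromℕ n ^ℤ (↥ r)
  0<y : 0ℚ < 1ℚ ⊓ z
  0<y with ⊓-sel 1ℚ z
  ... | inj₁ e = subst (0ℚ <_) (sym e) 0<1
  ... | inj₂ e = subst (0ℚ <_) (sym e) (^ℤ-pos (<-≤-trans 0<1 (1≤fromℕ n)) (↥ r))

above-pow : ∀ n r → ∃ (AbovePow n r)
above-pow n r@(mkℚ _ d _) = 1ℚ ⊔ z , <-≤-trans 0<1 (p≤p⊔q 1ℚ z) ,
    ≤-trans (p≤q⊔p 1ℚ z) (≤-^-suc (p≤p⊔q 1ℚ z) d)
  where z = fromℕ n ^ℤ (↥ r)

pow-disjoint : ∀ n .{{_ : ℕ.NonZero n}} {r r′ y y′} → r < r′ → BelowPow n r y → AbovePow n r′ y′ → y ≤ y′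
pow-disjoint n {r@record{}} {r′@record{}} {y} {y′} r<r′ (0<y , y≤) (0<y′ , ≤y′) =
  ^-cancel-≤ 0<y′ (d ℕ.* d′) {{ℕ.m*n≢0 d d′}}
    (subst₂ _≤_ (^-assocʳ y d d′)
                (trans (^-assocʳ y′ d′ d) (cong (y′ ^_) (ℕ.*-comm d′ d)))
    (≤-trans (^-mono-≤ (^-pos 0<y d) y≤ d′)
    (≤-trans (≤-reflexive (^ℤ-assoc 0<N (↥ r) d′))
    (≤-trans (^ℤ-mono (1≤fromℕ n) (ℤ.<⇒≤ (drop-*<* r<r′)))
    (≤-trans (≤-reflexive (sym (^ℤ-assoc 0<N (↥ r′) d)))
             (^-mono-≤ (^ℤ-pos 0<N (↥ r′)) ≤y′ d))))))
  where
  d = ↧ₙ r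
  d′ = ↧ₙ r′
  0<N = <-≤-trans 0<1 (1≤fromℕ n)

pow-step : ∀ {N} → 0ℚ < N → ∀ {i j} d e M .{{_ : ℕ.NonZero d}} .{{_ : ℕ.NonZero M}} {y y′} →
           0ℚ < y → 0ℚ < y′ → j ℤ.* + (d ℕ.* M) ≡ (i ℤ.* + M ℤ.+ + d) ℤ.* + e →
           N ^ℤ i ≤ y ^ d → N * y ^ M ≤ y′ ^ M → N ^ℤ j ≤ y′ ^ e
pow-step {N} 0<N {i} {j} d e M {y} {y′} 0<y 0<y′ eq ≤y ≤y′ =
  ^-cancel-≤ (^-pos 0<y′ e) (d ℕ.* M) {{ℕ.m*n≢0 d M}}
    (≤-trans (≤-reflexive lhs) (≤-trans (^-mono-≤ (^ℤ-pos 0<N k) step e) (≤-reflexive rhs)))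
  where
  k = i ℤ.* + M ℤ.+ + d
  lhs : (N ^ℤ j) ^ (d ℕ.* M) ≡ (N ^ℤ k) ^ e
  lhs = trans (^ℤ-assoc 0<N j (d ℕ.* M)) (trans (cong (N ^ℤ_) eq) (sym (^ℤ-assoc 0<N k e)))
  rhs : ((y′ ^ M) ^ d) ^ e ≡ (y′ ^ e) ^ (d ℕ.* M)
  rhs = trans (cong (_^ e) (^-assocʳ y′ M d)) (trans (^-assocʳ y′ (M ℕ.* d) e)
    (trans (cong (y′ ^_) (trans (ℕ.*-comm (M ℕ.* d) e) (cong (e ℕ.*_) (ℕ.*-comm M d))))
           (sym (^-assocʳ y′ e (d ℕ.* M)))))
  swap : (y ^ d) ^ M ≡ (y ^ M) ^ d
  swap = trans (^-assocʳ y d M) (trans (cong (y ^_) (ℕ.*-comm d M)) (sym (^-assocʳ y M d)))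
  step : N ^ℤ k ≤ (y′ ^ M) ^ d
  step =
    ≤-trans (≤-reflexive (trans (cong (N ^ℤ_) (ℤ.+-comm (i ℤ.* + M) (+ d)))
      (trans (^ℤ-+ 0<N (i ℤ.* + M) d) (cong (N ^ d *_) (sym (^ℤ-assoc 0<N i M))))))
    (≤-trans (*-monoˡ-≤-nonNeg (N ^ d) {{nonNegative (<⇒≤ (^-pos 0<N d))}}
      (^-mono-≤ (^ℤ-pos 0<N i) ≤y M))
    (≤-trans (≤-reflexive (trans (cong (N ^ d *_) swap) (sym (^-distrib-* N (y ^ M) d))))
      (^-mono-≤ (*-pos 0<N (^-pos 0<y M)) ≤y′ d)))

shift-fraction : ∀ a m → ↥ (a + + 1 / suc m) ℤ.* + (↧ₙ a ℕ.* suc m) ≡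
                 (↥ a ℤ.* + suc m ℤ.+ + (↧ₙ a)) ℤ.* + (↧ₙ (a + + 1 / suc m))
shift-fraction a@record{} m = go (a + + 1 / suc m)
  (ℚᵘ.≃-trans (toℚᵘ-homo-+ a (+ 1 / suc m))
    (ℚᵘ.+-congʳ (toℚᵘ a) (toℚᵘ-fromℚᵘ (ℚᵘ.mkℚᵘ (+ 1) m))))
  where
  go : ∀ b → toℚᵘ b ℚᵘ.≃ toℚᵘ a ℚᵘ.+ ℚᵘ.mkℚᵘ (+ 1) m →
       ↥ b ℤ.* + (↧ₙ a ℕ.* suc m) ≡ (↥ a ℤ.* + suc m ℤ.+ + (↧ₙ a)) ℤ.* + (↧ₙ b)
  go b@(mkℚ _ _ _) (ℚᵘ.*≡* e) = trans e
    (cong (λ t → (↥ a ℤ.* + suc m ℤ.+ t) ℤ.* + (↧ₙ b)) (ℤ.*-identityˡ (+ (↧ₙ a))))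

-- n ^ s is the supremum of n ^ r over rationals r < s, equivalently the infimum
-- over rationals r > s; this uses n ≥ 1.
infixr 8 _^ᴿ_
_^ᴿ_ : (n : ℕ) .{{_ : ℕ.NonZero n}} → ℝ → ℝ
n ^ᴿ s = record
  { L = Lower
  ; U = Upper
  ; L-inhabited = let r , Lr = L-inhabited s ; y , Y = below-pow n r ; q , q<y = below y in
      q , r , y , Lr , Y , q<y
  ; U-inhabited = let r , Ur = U-inhabited s ; y , Y = above-pow n r ; q , y<q = above y in
      q , r , y , Ur , Y , y<q
  ; L-lower = λ { p<q (r , y , Lr , Y , q<y) → r , y , Lr , Y , <-trans p<q q<y }
  ; U-upper = λ { p<q (r , y , Ur , Y , y<p) → r , y , Ur , Y , <-trans y<p p<q }
  ; L-open = λ { (r , y , Lr , Y , q<y) → let t , q<t , t<y = <-dense q<y in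
      t , q<t , r , y , Lr , Y , t<y }
  ; U-open = λ { (r , y , Ur , Y , y<q) → let t , y<t , t<q = <-dense y<q in
      t , t<q , r , y , Ur , Y , y<t }
  ; disjoint = λ { (r , y , Lr , Y , q<y) (r′ , y′ , Ur′ , Y′ , y′<q) →
      <-irrefl refl (<-≤-trans (<-trans y′<q q<y) (pow-disjoint n (L<U s Lr Ur′) Y Y′)) }
  ; located = loc
  }
  where
  Lower Upper : ℚ → Set
  Lower q = ∃₂ λ r y → L s r × BelowPow n r y × q < y
  Upper q = ∃₂ λ r y → U s r × AbovePow n r y × y < q

  0<N = <-≤-trans 0<1 (1≤fromℕ n)

  loc : ∀ {p q} → p < q → Lower p ⊎ Upper q
  loc {p} {q} p<q = split (0ℚ <? p)
    where
    split : Dec (0ℚ < p) → Lower p ⊎ Upper q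
    split (no 0≮p) = let r , Lr = L-inhabited s ; y , Y = below-pow n r in
      inj₁ (r , y , Lr , Y , ≤-<-trans (≮⇒≥ 0≮p) (proj₁ Y))
    split (yes 0<p) = between (<-dense p<q)
      where
      between : (∃ λ y → p < y × y < q) → Lower p ⊎ Upper q
      between (y , p<y , y<q) = between′ (<-dense y<q)
        where
        0<y = <-trans 0<p p<y
        between′ : (∃ λ y′ → y < y′ × y′ < q) → Lower p ⊎ Upper q
        between′ (y′ , y<y′ , y′<q) = refine (powers-unbounded 0<y y<y′ (fromℕ n))
          where
          0<y′ = <-trans 0<y y<y′
          refine : (∃ λ m → fromℕ n * y ^ suc m ≤ y′ ^ suc m) → Lower p ⊎ Upper q
          refine (m , N*y≤y′) = decide (approx s (positive⁻¹ (+ 1 / suc m) {{normalize-pos 1 (suc m)}}))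
            where
            decide : (∃ λ a → L s a × U s (a + + 1 / suc m)) → Lower p ⊎ Upper q
            decide (a , La , Ub) = compare (y ^ (↧ₙ a) ≤? fromℕ n ^ℤ (↥ a))
              where
              compare : Dec (y ^ (↧ₙ a) ≤ fromℕ n ^ℤ (↥ a)) → Lower p ⊎ Upper q
              compare (yes le) = inj₁ (a , y , La , (0<y , le) , p<y)
              compare (no ¬le) = inj₂ (a + + 1 / suc m , y′ , Ub ,
                (0<y′ , pow-step 0<N {↥ a} {↥ (a + + 1 / suc m)} (↧ₙ a) (↧ₙ (a + + 1 / suc m)) (suc m) 0<y 0<y′
                          (shift-fraction a m) (<⇒≤ (≰⇒> ¬le)) N*y≤y′) ,
                y′<q)

-- Only used at x ≥ 2, where both reciprocals are genuine.
E : ℚ → ℚ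
E x = (1ℚ - (x ^ 2) ⁻¹) ⁻¹

primeDivisors : ℕ → List ℕ
primeDivisors m = List.filter (λ p → prime? p ×-dec p ∣? m) (List.upTo (suc m))

∏ : List ℕ → (ℕ → ℚ) → ℚ
∏ ps f = List.foldr (λ p acc → f p * acc) 1ℚ ps

∏E : ℕ → ℚ
∏E m = ∏ (primeDivisors m) (λ p → E (fromℕ p))

A : ℕ → Vec (Vec ℚ 2) 2
A n = (∏E (2 ℕ.* n ℕ.+ 1)        Vec.∷ E (fromℕ (2 ℕ.* n ℕ.+ 1)) Vec.∷ Vec.[]) Vec.∷
      (E (fromℕ (2 ℕ.* n ℕ.+ 3)) Vec.∷ ∏E (2 ℕ.* n ℕ.+ 3)        Vec.∷ Vec.[]) Vec.∷ Vec.[]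

det : Vec (Vec ℚ 2) 2 → ℚ
det ((a Vec.∷ b Vec.∷ Vec.[]) Vec.∷ (c Vec.∷ d Vec.∷ Vec.[]) Vec.∷ Vec.[]) = a * d - b * c

-- det (A n) ≥ 0, which makes 1 + det (A n) * n ^ s positive.

0<1-x⁻² : ∀ {x} → 1ℚ < x → 0ℚ < 1ℚ - (x ^ 2) ⁻¹
0<1-x⁻² {x} 1<x = p<q⇒0<q-p
  (⁻¹-anti-< 0<1 (subst (_< x ^ 2) (1^ 2) (^-mono-< 0<1 1<x 2)))

E-anti : ∀ {x y} → 1ℚ < x → x ≤ y → E y ≤ E x
E-anti {x} {y} 1<x x≤y = ⁻¹-anti-≤ (0<1-x⁻² 1<x)
  (+-monoʳ-≤ 1ℚ (neg-antimono-≤ (⁻¹-anti-≤ (^-pos 0<x 2) (^-mono-≤ 0<x x≤y 2))))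
  where 0<x = <-trans 0<1 1<x

1≤E : ∀ {x} → 1ℚ < x → 1ℚ ≤ E x
1≤E {x} 1<x = ⁻¹-anti-≤ {1ℚ - (x ^ 2) ⁻¹} {1ℚ} (0<1-x⁻² 1<x)
  (lin≤ (<⇒≤ (⁻¹-pos (^-pos (<-trans 0<1 1<x) 2)))
    (solve 1 (λ i → con 1ℚ :- i :+ i := con 1ℚ :+ con 0ℚ) refl ((x ^ 2) ⁻¹)))
  where open +-*-Solver

1<fromℕ : ∀ {n} → 2 ℕ.≤ n → 1ℚ < fromℕ n
1<fromℕ 2≤n = <-≤-trans (toWitness {a? = 1ℚ <? fromℕ 2} _) (fromℕ-mono-≤ 2≤n)

2≤prime : ∀ {p} → Prime p → 2 ℕ.≤ p
2≤prime {suc (suc p)} _ = ℕ.s≤s (ℕ.s≤s ℕ.z≤n)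

1≤∏E : ∀ ps → (∀ {p} → p ∈ ps → Prime p) → 1ℚ ≤ ∏ ps (λ p → E (fromℕ p))
1≤∏E []       pr = ≤-refl
1≤∏E (p ∷ ps) pr = *-mono-≤ {1ℚ} {c = 1ℚ} (<⇒≤ 0<1) (≤-trans (<⇒≤ 0<1) rest)
                     (1≤E (1<fromℕ (2≤prime (pr (here refl))))) rest
  where rest = 1≤∏E ps (λ i → pr (there i))

E≤∏E : ∀ {q} ps → (∀ {p} → p ∈ ps → Prime p) → q ∈ ps → E (fromℕ q) ≤ ∏ ps (λ p → E (fromℕ p))
E≤∏E {q} (p ∷ ps) pr (here refl) = subst (_≤ E (fromℕ q) * ∏ ps (λ p → E (fromℕ p))) (*-identityʳ (E (fromℕ q)))
  (*-mono-≤ {c = 1ℚ} (≤-trans (<⇒≤ 0<1) h) (≤-trans (<⇒≤ 0<1) rest) (≤-refl {E (fromℕ q)}) rest)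
  where
  h    = 1≤E (1<fromℕ (2≤prime (pr (here refl))))
  rest = 1≤∏E ps (λ i → pr (there i))
E≤∏E {q} (p ∷ ps) pr (there i) = subst (_≤ E (fromℕ p) * ∏ ps (λ p → E (fromℕ p))) (*-identityˡ (E (fromℕ q)))
  (*-mono-≤ {1ℚ} (<⇒≤ 0<1) (≤-trans (<⇒≤ 0<1) (1≤∏E ps pr′))
    (1≤E (1<fromℕ (2≤prime (pr (here refl))))) (E≤∏E ps pr′ i))
  where
  pr′ : ∀ {p} → p ∈ ps → Prime p
  pr′ j = pr (there j)

primeDivisor : ∀ m → 2 ℕ.≤ m → ∃ λ p → Prime p × p ∣ m
primeDivisor m@(suc _) 2≤m = go (factorise m)
  where
  go : PrimeFactorisation m → ∃ λ p → Prime p × p ∣ m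
  go record { factors = []     ; isFactorisation = e } = ⊥-elim (ℕ.<⇒≢ 2≤m (sym e))
  go record { factors = p ∷ ps ; isFactorisation = e ; factorsPrime = pr ∷ _ } =
    p , pr , subst (p ∣_) (sym e) (∣m⇒∣m*n (product ps) ∣-refl)

E≤∏E-primeDivisors : ∀ m → 2 ℕ.≤ m → E (fromℕ m) ≤ ∏E m
E≤∏E-primeDivisors m@(suc _) 2≤m = go (primeDivisor m 2≤m)
  where
  P? : ∀ p → Dec (Prime p × p ∣ m)
  P? p = prime? p ×-dec p ∣? m
  go : (∃ λ p → Prime p × p ∣ m) → E (fromℕ m) ≤ ∏E m
  go (p , pr , p∣m) = ≤-trans
    (E-anti (1<fromℕ (2≤prime pr)) (fromℕ-mono-≤ (∣⇒≤ p∣m)))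
    (E≤∏E (primeDivisors m) (λ i → proj₁ (proj₂ (∈-filter⁻ P? {xs = List.upTo (suc m)} i)))
      (∈-filter⁺ P? (∈-upTo⁺ (ℕ.s≤s (∣⇒≤ p∣m))) (pr , p∣m)))

0≤det : ∀ n .{{_ : ℕ.NonZero n}} → 0ℚ ≤ det (A n)
0≤det n@(suc k) = lin≤ (*-mono-≤ (≤-trans (<⇒≤ 0<1) (1≤E (1<fromℕ 2≤m))) 0≤∏ lo₁ lo₂)
    (solve 4 (λ a b c d → con 0ℚ :+ a :* d := a :* d :- b :* c :+ b :* c) refl
      (∏E m) (E (fromℕ m)) (E (fromℕ m′)) (∏E m′))
  where
  open +-*-Solver
  m  = 2 ℕ.* n ℕ.+ 1
  m′ = 2 ℕ.* n ℕ.+ 3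
  2≤2n : 2 ℕ.≤ 2 ℕ.* n
  2≤2n = ℕ.*-monoʳ-≤ 2 {1} {n} (ℕ.s≤s ℕ.z≤n)
  2≤m  = ℕ.≤-trans 2≤2n (ℕ.m≤m+n (2 ℕ.* n) 1)
  2≤m′ = ℕ.≤-trans 2≤2n (ℕ.m≤m+n (2 ℕ.* n) 3)
  lo₁ = E≤∏E-primeDivisors m 2≤m
  lo₂ = E≤∏E-primeDivisors m′ 2≤m′
  0≤∏ = ≤-trans (≤-trans (<⇒≤ 0<1) (1≤E (1<fromℕ 2≤m′))) lo₂

0<1+d*x : ∀ {d x} → 0ℚ ≤ d → 0ᴿ <ᴿ x → 0ᴿ <ᴿ 1ᴿ +ᴿ fromℚ d *ᴿ x
0<1+d*x {d} {x} 0≤d (l , 0<l , Ll) =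
    ¼ , toWitness {a? = 0ℚ <? ¼} _ ,
    (½ + ¼ , - ¼ , toWitness {a? = ½ + ¼ <? 1ℚ} _ , Lprod , toWitness {a? = ¼ <? ½ + ¼ + - ¼} _)
  where
  open +-*-Solver
  u = proj₁ (U-inhabited x)
  Uu = proj₂ (U-inhabited x)
  0<u = <-trans 0<l (L<U x Ll Uu)
  tol = tolerance 0<u (*-pos 0<½ (*-pos 0<½ 0<½))
  Lprod : (fromℚ d *ᴿ x) .L (- ¼)
  Lprod = go tol (above d)
    where
    go : (∃ λ ε → 0ℚ < ε × ε ≤ 1ℚ × ε * u ≤ ½ * ¼) → (∃ λ d′ → d < d′) → (fromℚ d *ᴿ x) .L (- ¼)
    go (ε , 0<ε , _ , εu≤) (d′ , d<d′) =
      - ε , d′ , l , u , (-ε<d , d<d′) , (Ll , Uu) ,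
      <-≤-trans (toWitness {a? = - ¼ <? - (½ * ¼)} _)
        (⊓-glb (⊓-glb (lo 0<l (<⇒≤ (L<U x Ll Uu))) (lo 0<u ≤-refl))
               (⊓-glb (hi 0<l) (hi 0<u)))
      where
      -ε<0 : - ε < 0ℚ
      -ε<0 = neg-antimono-< 0<ε
      -ε<d = <-≤-trans -ε<0 0≤d
      lo : ∀ {v} → 0ℚ < v → v ≤ u → - (½ * ¼) ≤ - ε * v
      lo {v} 0<v v≤u = subst (- (½ * ¼) ≤_) (neg-distribˡ-* ε v) (neg-antimono-≤
        (≤-trans (*-monoˡ-≤-nonNeg ε {{nonNegative (<⇒≤ 0<ε)}} v≤u) εu≤))
      hi : ∀ {v} → 0ℚ < v → - (½ * ¼) ≤ d′ * v
      hi {v} 0<v = ≤-trans (toWitness {a? = - (½ * ¼) ≤? 0ℚ} _) (<⇒≤ (*-pos {d′} {v} (≤-<-trans 0≤d d<d′) 0<v))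

0<n^s : ∀ n .{{_ : ℕ.NonZero n}} s → 0ᴿ <ᴿ n ^ᴿ s
0<n^s n s = let r , Lr = L-inhabited s ; y , Y = below-pow n r ; q , 0<q , q<y = <-dense (proj₁ Y) in
  q , 0<q , r , y , Lr , Y , q<y

term : ℝ → (n : ℕ) .{{_ : ℕ.NonZero n}} → ℝ
term s n = 1/ᴿ (1ᴿ +ᴿ fromℚ (det (A n)) *ᴿ n ^ᴿ s)
  (0<1+d*x {det (A n)} {n ^ᴿ s} (0≤det n) (0<n^s n s))

-- Series are indexed from 1: partialSum a k = a 1 + ⋯ + a k.
partialSum : ((n : ℕ) .{{_ : ℕ.NonZero n}} → ℝ) → ℕ → ℝ
partialSum a zero    = 0ᴿ
partialSum a (suc k) = partialSum a k +ᴿ a (suc k)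

-- | S_k - ℓ | < ε eventually; positive rational ε suffice as ℚ is dense in ℝ.
SeriesConvergesTo : ((n : ℕ) .{{_ : ℕ.NonZero n}} → ℝ) → ℝ → Set
SeriesConvergesTo a ℓ = ∀ {ε} → 0ℚ < ε → ∃ λ K → ∀ k → K ℕ.≤ k →
  (partialSum a k <ᴿ ℓ +ᴿ fromℚ ε) × (ℓ <ᴿ partialSum a k +ᴿ fromℚ ε)

SeriesConverges : ((n : ℕ) .{{_ : ℕ.NonZero n}} → ℝ) → Set₁
SeriesConverges a = ∃ (SeriesConvergesTo a)

TwinPrimes : ℕ × ℕ → Set
TwinPrimes (p , q) = q ≡ p ℕ.+ 2 × Prime p × Prime q

-- A duplicate-free list enumerating exactly the elements satisfying P.
HasCardinality : {X : Set} → (X → Set) → ℕ → Set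
HasCardinality P N = ∃ λ xs → Unique xs × (∀ x → x ∈ xs ⇔ P x) × List.length xs ≡ N

FinitelyMany : {X : Set} → (X → Set) → Set
FinitelyMany P = ∃ (HasCardinality P)

{-# OPTIONS --safe #-}
-- If 2n+1 and 2n+3 are both prime then |A_n| = 0 and the n-th term is 1. If m, one of them, is
-- composite, it has a prime factor q with q² ≤ m, and E(q) ≥ E(m) + 1/m gives |A_n| ≥ 1/(2n+3), so
-- the n-th term is O(n^(1-s)) with 1 - s < -1. Hence τ(s), the sum over the n of the second kind,
-- converges for s > 2, and each twin pair adds exactly 1 to the partial sums.
module Submission where

open import Defs
open import Algebra.Bundles using (CommutativeRing)
open import Data.Empty using (⊥; ⊥-elim)
open import Data.Integer.Base using (+_)
open import Data.List.Base as List using (List; []; _∷_; downFrom)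
open import Data.List.Membership.Propositional using (_∈_)
open import Data.List.Membership.Propositional.Properties using (∈-filter⁺; ∈-filter⁻; ∈-upTo⁺; ∈-map⁺; ∈-map⁻; ∈-downFrom⁺)
open import Data.List.Membership.Propositional.Properties.WithK using (unique∧set⇒bag)
open import Data.List.Properties using (filter-accept; filter-reject; length-map)
open import Data.List.Relation.Binary.BagAndSetEquality using (∼bag⇒↭)
open import Data.List.Relation.Binary.Permutation.Propositional.Properties using (↭-length)
open import Data.List.Relation.Unary.All using ([]; _∷_)
open import Data.List.Relation.Unary.AllPairs using ([]; _∷_)
open import Data.List.Relation.Unary.Any using (here; there)
open import Data.List.Relation.Unary.Unique.Propositional using (Unique)
open import Data.List.Relation.Unary.Unique.Propositional.Properties using (filter⁺; upTo⁺; map⁺; downFrom⁺)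
open import Data.Nat.Base using (ℕ; zero; suc)
open import Data.Nat.Divisibility using (_∣_; _∣?_; divides; ∣⇒≤; ∣m⇒∣m*n; ∣n⇒∣m*n; ∣-refl)
open import Data.Nat.ListAction using (product)
open import Data.Nat.Primality using (Prime; prime?; prime⇒irreducible; ¬prime[1])
open import Data.Nat.Primality.Factorisation using (PrimeFactorisation; factorise)
open import Data.Product.Base using (∃; _×_; _,_; proj₁; proj₂)
open import Data.Rational.Base
open import Data.Rational.Properties
open import Data.Rational.Solver using (module +-*-Solver)
open import Data.Sum.Base using (_⊎_; inj₁; inj₂)
open import Data.Unit.Base using (tt)
open import Function.Base using (_∘_)
open import Function.Bundles using (_⇔_; mk⇔; Equivalence)
open import Relation.Binary.PropositionalEquality using (_≡_; refl; sym; trans; cong; cong₂; subst; subst₂)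
open import Relation.Nullary using (Dec; yes; no; ¬_)
open import Relation.Nullary.Decidable using (_×-dec_; toWitness; toWitnessFalse)

import Data.Integer as ℤ
import Data.Integer.Properties as ℤ
import Data.Nat as ℕ
import Data.Nat.Properties as ℕ

open import Algebra.Properties.Semiring.Exp (CommutativeRing.semiring +-*-commutativeRing) using (_^_; ^-homo-*; ^-assocʳ)

open ℝ

-- Embedding of the naturals into the rationals.

fromℕ-+ : ∀ m n → fromℕ (m ℕ.+ n) ≡ fromℕ m + fromℕ n
fromℕ-+ zero    n = sym (+-identityˡ (fromℕ n))
fromℕ-+ (suc m) n = trans (fromℕ-suc (m ℕ.+ n)) (trans (cong (λ t → 1ℚ + t) (fromℕ-+ m n))
  (trans (sym (+-assoc 1ℚ (fromℕ m) (fromℕ n))) (cong (_+ fromℕ n) (sym (fromℕ-suc m)))))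

fromℕ-* : ∀ m n → fromℕ (m ℕ.* n) ≡ fromℕ m * fromℕ n
fromℕ-* zero    n = sym (*-zeroˡ (fromℕ n))
fromℕ-* (suc m) n = trans (fromℕ-+ n (m ℕ.* n)) (trans (cong (λ t → fromℕ n + t) (fromℕ-* m n))
  (trans (solve 2 (λ m n → n :+ m :* n := (con 1ℚ :+ m) :* n) refl (fromℕ m) (fromℕ n))
         (cong (_* fromℕ n) (sym (fromℕ-suc m)))))
  where open +-*-Solver

fromℕ-^ : ∀ m k → fromℕ (m ℕ.^ k) ≡ fromℕ m ^ k
fromℕ-^ m zero    = refl
fromℕ-^ m (suc k) = trans (fromℕ-* m (m ℕ.^ k)) (cong (λ t → fromℕ m * t) (fromℕ-^ m k))

-- Twin indices and the vanishing of the determinant.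

∀∈≡⇒singleton : ∀ {X : Set} {x : X} {xs} → Unique xs → x ∈ xs → (∀ {y} → y ∈ xs → y ≡ x) → xs ≡ x ∷ []
∀∈≡⇒singleton {xs = y ∷ []}     _              _ h = cong (_∷ []) (h (here refl))
∀∈≡⇒singleton {xs = y ∷ z ∷ zs} ((y≢z ∷ _) ∷ _) _ h =
  ⊥-elim (y≢z (trans (h (here refl)) (sym (h (there (here refl))))))

prime∣prime⇒≡ : ∀ {p q} → Prime p → Prime q → p ∣ q → p ≡ q
prime∣prime⇒≡ pp pq p∣q with prime⇒irreducible pq p∣q
... | inj₁ refl = ⊥-elim (¬prime[1] pp)
... | inj₂ e    = e

primeDivisors-prime : ∀ {m} → Prime m → primeDivisors m ≡ m ∷ []
primeDivisors-prime {m} pm = ∀∈≡⇒singleton (filter⁺ P? (upTo⁺ (suc m)))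
  (∈-filter⁺ P? (∈-upTo⁺ (ℕ.n<1+n m)) (pm , ∣-refl))
  (λ i → let _ , pr , p∣m = ∈-filter⁻ P? {xs = List.upTo (suc m)} i in prime∣prime⇒≡ pr pm p∣m)
  where
  P? : ∀ p → Dec (Prime p × p ∣ m)
  P? p = prime? p ×-dec p ∣? m

∏E-prime : ∀ {m} → Prime m → ∏E m ≡ E (fromℕ m)
∏E-prime {m} pm = trans (cong (λ ps → ∏ ps (λ p → E (fromℕ p))) (primeDivisors-prime pm))
                        (*-identityʳ (E (fromℕ m)))

TwinIndex : ℕ → Set
TwinIndex n = Prime (2 ℕ.* n ℕ.+ 1) × Prime (2 ℕ.* n ℕ.+ 3)

twinIndex? : ∀ n → Dec (TwinIndex n)
twinIndex? n = prime? (2 ℕ.* n ℕ.+ 1) ×-dec prime? (2 ℕ.* n ℕ.+ 3)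

-- Each product over prime divisors has a single factor, so the diagonal and antidiagonal products
-- agree.
det-twin : ∀ n → TwinIndex n → det (A n) ≡ 0ℚ
det-twin n (pm , pm′) = trans
  (cong (λ t → t - E (fromℕ m) * E (fromℕ m′)) (cong₂ _*_ (∏E-prime pm) (∏E-prime pm′)))
  (+-inverseʳ (E (fromℕ m) * E (fromℕ m′)))
  where
  m m′ : ℕ
  m  = 2 ℕ.* n ℕ.+ 1
  m′ = 2 ℕ.* n ℕ.+ 3

-- Lower bound for the determinant at non-twin indices.

-- A composite m has at least two prime factors p and q with multiplicity; the smaller one has
-- square at most p q, which divides m.
small-primeDivisor : ∀ m → 2 ℕ.≤ m → ¬ Prime m → ∃ λ q → Prime q × q ∣ m × q ℕ.* q ℕ.≤ m
small-primeDivisor m@(suc _) 2≤m ¬pm = go (factorise m)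
  where
  go : PrimeFactorisation m → ∃ λ q → Prime q × q ∣ m × q ℕ.* q ℕ.≤ m
  go record { factors = [] ; isFactorisation = e } = ⊥-elim (ℕ.<⇒≢ 2≤m (sym e))
  go record { factors = p ∷ [] ; isFactorisation = e ; factorsPrime = pr ∷ _ } =
    ⊥-elim (¬pm (subst Prime (sym (trans e (ℕ.*-identityʳ p))) pr))
  go record { factors = p ∷ q ∷ ps ; isFactorisation = e ; factorsPrime = pp ∷ pq ∷ _ } =
    choose (ℕ.≤-total p q)
    where
    p∣m = subst (p ∣_) (sym e) (∣m⇒∣m*n (q ℕ.* product ps) ∣-refl)
    q∣m = subst (q ∣_) (sym e) (∣n⇒∣m*n p (∣m⇒∣m*n (product ps) ∣-refl))
    pq∣m = subst (p ℕ.* q ∣_) (trans (ℕ.*-assoc p q (product ps)) (sym e))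
             (∣m⇒∣m*n (product ps) (∣-refl {p ℕ.* q}))
    choose : p ℕ.≤ q ⊎ q ℕ.≤ p → ∃ λ q → Prime q × q ∣ m × q ℕ.* q ℕ.≤ m
    choose (inj₁ p≤q) = p , pp , p∣m , ℕ.≤-trans (ℕ.*-monoʳ-≤ p p≤q) (∣⇒≤ pq∣m)
    choose (inj₂ q≤p) = q , pq , q∣m , ℕ.≤-trans (ℕ.*-monoˡ-≤ q q≤p) (∣⇒≤ pq∣m)

-- With u = 1/m the two values are 1/(1 - u²) and at least 1/(1 - u), whose difference is u/(1 - u²).
E+⁻¹≤E : ∀ {x m} → 1ℚ < x → 1ℚ < m → x * x ≤ m → E m + m ⁻¹ ≤ E x
E+⁻¹≤E {x} {m} 1<x 1<m x²≤m = ≤-trans E+u≤e e≤E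
  where
  open +-*-Solver
  0<m = <-trans 0<1 1<m
  0<x = <-trans 0<1 1<x
  u f e : ℚ
  u = m ⁻¹
  f = E m
  e = (1ℚ - u) ⁻¹
  u²≡ : (m ^ 2) ⁻¹ ≡ u * u
  u²≡ = trans (sym (⁻¹-^ 0<m 2)) (cong (λ t → u * t) (*-identityʳ u))
  u<1 : u < 1ℚ
  u<1 = ⁻¹-anti-< {1ℚ} {m} 0<1 1<m
  0<1-u = p<q⇒0<q-p u<1
  f+uf≡e : f + u * f ≡ e
  f+uf≡e = ⁻¹-unique 0<1-u
    (trans (solve 2 (λ u f → (con 1ℚ :- u) :* (f :+ u :* f) := (con 1ℚ :- u :* u) :* f) refl u f)
    (trans (cong (λ t → (1ℚ - t) * f) (sym u²≡)) (⁻¹-inverseʳ (0<1-x⁻² 1<m))))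
  E+u≤e : f + u ≤ e
  E+u≤e = subst (f + u ≤_) f+uf≡e (+-monoʳ-≤ f (subst (_≤ u * f) (*-identityʳ u)
    (*-monoˡ-≤-nonNeg u {{nonNegative (<⇒≤ (⁻¹-pos 0<m))}} (1≤E 1<m))))
  e≤E : e ≤ E x
  e≤E = ⁻¹-anti-≤ (0<1-x⁻² 1<x) (+-monoʳ-≤ 1ℚ (neg-antimono-≤ (⁻¹-anti-≤ (^-pos 0<x 2)
    (subst (_≤ m) (cong (λ t → x * t) (sym (*-identityʳ x))) x²≤m))))

-- All factors of the product are at least 1, so it dominates its factor at a prime q with q² ≤ m,
-- and that factor exceeds E(m) by 1/m or more.
∏E-composite : ∀ m → 2 ℕ.≤ m → ¬ Prime m → E (fromℕ m) + (fromℕ m) ⁻¹ ≤ ∏E m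
∏E-composite m 2≤m ¬pm = go (small-primeDivisor m 2≤m ¬pm)
  where
  P? : ∀ p → Dec (Prime p × p ∣ m)
  P? p = prime? p ×-dec p ∣? m
  go : (∃ λ q → Prime q × q ∣ m × q ℕ.* q ℕ.≤ m) → E (fromℕ m) + (fromℕ m) ⁻¹ ≤ ∏E m
  go (q , pq , q∣m , q²≤m) = ≤-trans
    (E+⁻¹≤E (1<fromℕ (2≤prime pq)) (1<fromℕ 2≤m)
      (subst (_≤ fromℕ m) (fromℕ-* q q) (fromℕ-mono-≤ q²≤m)))
    (E≤∏E (primeDivisors m) (λ i → proj₁ (proj₂ (∈-filter⁻ P? {xs = List.upTo (suc m)} i)))
      (∈-filter⁺ P? (∈-upTo⁺ (ℕ.s≤s (∣⇒≤ {{ℕ.>-nonZero (ℕ.<-trans (ℕ.s≤s ℕ.z≤n) 2≤m)}} q∣m))) (pq , q∣m)))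

-- Expanding a b ≥ (e + u) f leaves an excess of u f, and f ≥ 1.
excess-product : ∀ {a b e f u} → 1ℚ ≤ f → 0ℚ ≤ e → 0ℚ ≤ u → e + u ≤ a → f ≤ b → u ≤ a * b - e * f
excess-product {a} {b} {e} {f} {u} 1≤f 0≤e 0≤u e+u≤a f≤b = ≤-trans
  (subst (_≤ u * f) (*-identityʳ u) (*-monoˡ-≤-nonNeg u {{nonNegative 0≤u}} 1≤f))
  (lin≤ (*-mono-≤ (+-mono-≤ 0≤e 0≤u) (≤-trans (≤-trans (<⇒≤ 0<1) 1≤f) f≤b) e+u≤a f≤b)
    (solve 5 (λ a b e f u → u :* f :+ a :* b := a :* b :- e :* f :+ (e :+ u) :* f) refl a b e f u))
  where open +-*-Solver

det-nonTwin : ∀ n .{{_ : ℕ.NonZero n}} → ¬ TwinIndex n → (fromℕ (2 ℕ.* n ℕ.+ 3)) ⁻¹ ≤ det (A n)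
det-nonTwin n@(suc _) ¬tw = go (prime? m) (prime? m′)
  where
  open +-*-Solver
  m m′ : ℕ
  m  = 2 ℕ.* n ℕ.+ 1
  m′ = 2 ℕ.* n ℕ.+ 3
  2≤2n : 2 ℕ.≤ 2 ℕ.* n
  2≤2n = ℕ.*-monoʳ-≤ 2 {1} {n} (ℕ.s≤s ℕ.z≤n)
  2≤m  = ℕ.≤-trans 2≤2n (ℕ.m≤m+n (2 ℕ.* n) 1)
  2≤m′ = ℕ.≤-trans 2≤2n (ℕ.m≤m+n (2 ℕ.* n) 3)
  m≤m′ : m ℕ.≤ m′
  m≤m′ = ℕ.+-monoʳ-≤ (2 ℕ.* n) {1} {3} (ℕ.s≤s ℕ.z≤n)
  0<fm = <-trans 0<1 (1<fromℕ 2≤m)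
  0<fm′ = <-trans 0<1 (1<fromℕ 2≤m′)
  1≤Em = 1≤E (1<fromℕ 2≤m)
  1≤Em′ = 1≤E (1<fromℕ 2≤m′)
  go : Dec (Prime m) → Dec (Prime m′) → (fromℕ m′) ⁻¹ ≤ det (A n)
  go (yes pm) (yes pm′) = ⊥-elim (¬tw (pm , pm′))
  go (no ¬pm) _ = ≤-trans (⁻¹-anti-≤ 0<fm (fromℕ-mono-≤ m≤m′))
    (excess-product 1≤Em′ (≤-trans (<⇒≤ 0<1) 1≤Em) (<⇒≤ (⁻¹-pos 0<fm))
      (∏E-composite m 2≤m ¬pm) (E≤∏E-primeDivisors m′ 2≤m′))
  -- The composite entry is now the second one: the same estimate with the two diagonal entries
  -- exchanged, and likewise the antidiagonal ones.
  go (yes _) (no ¬pm′) = subst ((fromℕ m′) ⁻¹ ≤_)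
    (solve 4 (λ a b c d → d :* a :- c :* b := a :* d :- b :* c) refl
      (∏E m) (E (fromℕ m)) (E (fromℕ m′)) (∏E m′))
    (excess-product 1≤Em (≤-trans (<⇒≤ 0<1) 1≤Em′) (<⇒≤ (⁻¹-pos 0<fm′))
      (∏E-composite m′ 2≤m′ ¬pm′) (E≤∏E-primeDivisors m 2≤m))

-- Rational bounds on sums, products and reciprocals of cuts.

x≡x-y+y : ∀ x y → x ≡ x - y + y
x≡x-y+y = solve 2 (λ x y → x := x :- y :+ y) refl
  where open +-*-Solver

+ᴿ-L : ∀ x y {p q} → L x p → L y q → L (x +ᴿ y) (p + q)
+ᴿ-L x y {q = q} Lp Lq = let p′ , p<p′ , Lp′ = L-open x Lp in p′ , q , Lp′ , Lq , +-monoˡ-< q p<p′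

+ᴿ-U : ∀ x y {p q} → U x p → U y q → U (x +ᴿ y) (p + q)
+ᴿ-U x y {q = q} Up Uq = let p′ , p′<p , Up′ = U-open x Up in p′ , q , Up′ , Uq , +-monoˡ-< q p′<p

-- Non-negativity phrased through negative rationals, so that `0ᴿ`, whose lower cut is open,
-- satisfies it.
NonNegᴿ : ℝ → Set
NonNegᴿ x = ∀ {b} → b < 0ℚ → L x b

+ᴿ-nonNeg-L : ∀ x y {q} → NonNegᴿ y → L x q → L (x +ᴿ y) q
+ᴿ-nonNeg-L x y {q} 0≤y Lq =
  let r , q<r , Lr = L-open x Lq ; m , q<m , m<r = <-dense q<r in
  -- The gap between q and r pays for the negative summand m - r: the two parts add up to m, still
  -- above q.
  r , m - r , Lr , 0≤y (lin< m<r (sym (trans (+-identityˡ m) (x≡x-y+y m r)))) ,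
  subst (q <_) (trans (x≡x-y+y m r) (+-comm (m - r) r)) q<m

-- The hypothesis encodes w ≤ y through the upper cut of y, which keeps comparisons of reals with
-- rationals at the level of rationals.
1+-U : ∀ y {w r} → (∀ {b} → U y b → w ≤ b) → U (1ᴿ +ᴿ y) r → 1ℚ + w ≤ r
1+-U y w≤ (a , b , 1<a , Ub , a+b<r) = ≤-trans (+-mono-≤ (<⇒≤ 1<a) (w≤ Ub)) (<⇒≤ a+b<r)

1+-L : ∀ y {w r} → (∀ {b} → L y b → b ≤ w) → L (1ᴿ +ᴿ y) r → r ≤ 1ℚ + w
1+-L y ≤w (a , b , a<1 , Lb , r<a+b) = ≤-trans (<⇒≤ r<a+b) (+-mono-≤ (<⇒≤ a<1) (≤w Lb))

fromℚ-*-U : ∀ {d} x {y v} → 0ℚ ≤ d → (∀ {b} → U x b → y ≤ b) → U (fromℚ d *ᴿ x) v → d * y ≤ v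
fromℚ-*-U {d} x 0≤d y≤ (a , a′ , b , b′ , (a<d , d<a′) , (Lb , Ub′) , max<v) =
  ≤-trans (*-monoˡ-≤-nonNeg d {{nonNegative 0≤d}} (y≤ Ub′))
  (≤-trans (≤max* {a} {a′} {b} (<⇒≤ a<d) (<⇒≤ d<a′) (<⇒≤ (L<U x Lb Ub′)) ≤-refl) (<⇒≤ max<v))

-- The point (0, b) lies in the enclosing rectangle and has product 0, so the largest corner product
-- is at least 0.
0*-U : ∀ {d} x {v} → d ≡ 0ℚ → U (fromℚ d *ᴿ x) v → 0ℚ ≤ v
0*-U x refl (a , a′ , b , b′ , (a<0 , 0<a′) , (Lb , Ub′) , max<v) =
  ≤-trans (≤-reflexive (sym (*-zeroˡ b)))
  (≤-trans (≤max* {a} {a′} {b} {b′} (<⇒≤ a<0) (<⇒≤ 0<a′) ≤-refl (<⇒≤ (L<U x Lb Ub′))) (<⇒≤ max<v))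

0*-L : ∀ {d} x {v} → d ≡ 0ℚ → L (fromℚ d *ᴿ x) v → v ≤ 0ℚ
0*-L x refl (a , a′ , b , b′ , (a<0 , 0<a′) , (Lb , Ub′) , v<min) =
  ≤-trans (<⇒≤ v<min)
  (≤-trans (min*≤ {a} {a′} {b} {b′} (<⇒≤ a<0) (<⇒≤ 0<a′) ≤-refl (<⇒≤ (L<U x Lb Ub′)))
           (≤-reflexive (*-zeroˡ b)))

-- Locatedness between `z ⁻¹` and c decides; the wrong answer would provide a rational r > x with r
-- < z, against the hypothesis.
1/ᴿ-U : ∀ x 0<x {z c} → 0ℚ < z → (∀ {r} → U x r → z ≤ r) → z ⁻¹ < c → U (1/ᴿ x 0<x) c
1/ᴿ-U x 0<x {z} 0<z z≤ z⁻¹<c with located (1/ᴿ x 0<x) z⁻¹<c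
... | inj₂ Uc = Uc
... | inj₁ (r , Ur , lt) = ⊥-elim (<-irrefl (trans (*-comm (z ⁻¹) z) (⁻¹-inverseʳ 0<z))
  (≤-<-trans (*-monoˡ-≤-nonNeg (z ⁻¹) {{nonNegative (<⇒≤ (⁻¹-pos 0<z))}} (z≤ Ur)) lt))

1/ᴿ-L : ∀ x 0<x {z q} → 0ℚ < z → (∀ {r} → L x r → r ≤ z) → q < z ⁻¹ → L (1/ᴿ x 0<x) q
1/ᴿ-L x 0<x {z} 0<z ≤z q<z⁻¹ with located (1/ᴿ x 0<x) q<z⁻¹
... | inj₁ Lq = Lq
... | inj₂ (r , (Lr , _) , lt) = ⊥-elim (<-irrefl (sym (trans (*-comm (z ⁻¹) z) (⁻¹-inverseʳ 0<z)))
  (<-≤-trans lt (*-monoˡ-≤-nonNeg (z ⁻¹) {{nonNegative (<⇒≤ (⁻¹-pos 0<z))}} (≤z Lr))))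

1/ᴿ-pos : ∀ x 0<x → L (1/ᴿ x 0<x) 0ℚ
1/ᴿ-pos x 0<x = let u , Uu = U-inhabited x in u , Uu , subst (_< 1ℚ) (sym (*-zeroˡ u)) 0<1

-- Bounds on single terms of the series.

module _ (s : ℝ) (n : ℕ) .{{nz : ℕ.NonZero n}} where

  private
    y : ℝ
    y = fromℚ (det (A n)) *ᴿ n ^ᴿ s
    0<1+y : 0ᴿ <ᴿ 1ᴿ +ᴿ y
    0<1+y = 0<1+d*x {det (A n)} {n ^ᴿ s} (0≤det n) (0<n^s n s)

  term-pos : L (term s n) 0ℚ
  term-pos = 1/ᴿ-pos (1ᴿ +ᴿ y) 0<1+y

  term-twin-L : ∀ {q} → TwinIndex n → q < 1ℚ → L (term s n) q
  term-twin-L tw = 1/ᴿ-L (1ᴿ +ᴿ y) 0<1+y 0<1 (1+-L y (0*-L {det (A n)} (n ^ᴿ s) (det-twin n tw)))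

  term-twin-U : ∀ {q} → TwinIndex n → 1ℚ < q → U (term s n) q
  term-twin-U tw = 1/ᴿ-U (1ᴿ +ᴿ y) 0<1+y 0<1 (1+-U y (0*-U {det (A n)} (n ^ᴿ s) (det-twin n tw)))

  term-U : ∀ {w z c} → 0ℚ < z → z ≤ det (A n) * w → (∀ {b} → U (n ^ᴿ s) b → w ≤ b) → z ⁻¹ < c →
           U (term s n) c
  term-U {w} {z} 0<z z≤ w≤ = 1/ᴿ-U (1ᴿ +ᴿ y) 0<1+y 0<z λ {r} Ur →
    ≤-trans (≤-trans z≤ (subst (_≤ 1ℚ + det (A n) * w) (+-identityˡ (det (A n) * w))
                               (+-monoˡ-≤ (det (A n) * w) (<⇒≤ 0<1))))
            (1+-U y {r = r} (λ {b} → fromℚ-*-U {det (A n)} (n ^ᴿ s) {v = b} (0≤det n) (λ {b′} → w≤ {b′})) Ur)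

-- For r = a/d > 2 in lowest terms a ≥ 2d + 1, so t ≤ n^(1/d) gives n² t ≤ n^r.
belowPow-> : ∀ n .{{_ : ℕ.NonZero n}} {r t} → fromℕ 2 < r → 0ℚ < t → t ^ (↧ₙ r) ≤ fromℕ n →
               BelowPow n r (fromℕ n * fromℕ n * t)
belowPow-> n {r@(mkℚ a _ _)} {t} 2<r 0<t t^d≤N = *-pos (*-pos 0<N 0<N) 0<t ,
  ≤-trans (≤-reflexive eq)
  (≤-trans (*-monoˡ-≤-nonNeg (N ^ (d ℕ.+ d)) {{nonNegative (<⇒≤ (^-pos 0<N (d ℕ.+ d)))}} t^d≤N)
  (≤-trans (≤-reflexive (*-comm (N ^ (d ℕ.+ d)) N)) (^ℤ-mono (1≤fromℕ n) 2d+1≤a)))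
  where
  d = ↧ₙ r
  N = fromℕ n
  0<N = <-≤-trans 0<1 (1≤fromℕ n)
  eq : (N * N * t) ^ d ≡ N ^ (d ℕ.+ d) * t ^ d
  eq = trans (^-distrib-* (N * N) t d)
    (cong (_* t ^ d) (trans (^-distrib-* N N d) (sym (^-homo-* N d d))))
  2d+1≤a : + suc (d ℕ.+ d) ℤ.≤ a
  2d+1≤a = ℤ.i<j⇒suc[i]≤j (subst₂ ℤ._<_
    (trans (sym (ℤ.pos-* 2 d)) (cong (λ k → + (d ℕ.+ k)) (ℕ.+-identityʳ d)))
    (ℤ.*-identityʳ a) (drop-*<* 2<r))

U-pow-≥ : ∀ s n .{{_ : ℕ.NonZero n}} {r y b} → L s r → BelowPow n r y → U (n ^ᴿ s) b → y ≤ b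
U-pow-≥ s n Lr below (r′ , y′ , Ur′ , above , y′<b) =
  ≤-trans (pow-disjoint n (L<U s Lr Ur′) below above) (<⇒≤ y′<b)

⅕ : ℚ
⅕ = + 1 / 5

2n+3≤5n : ∀ n .{{_ : ℕ.NonZero n}} → 2 ℕ.* n ℕ.+ 3 ℕ.≤ 5 ℕ.* n
2n+3≤5n n@(suc _) = ℕ.≤-trans (ℕ.+-monoʳ-≤ (2 ℕ.* n) (ℕ.m≤m*n 3 n))
  (ℕ.≤-reflexive (sym (ℕ.*-distribʳ-+ n 2 3)))

-- Since 2n + 3 ≤ 5n for n ≥ 1, the determinant is at least 1/(5n), and one factor n of n² t
-- survives.
det-nonTwin-* : ∀ n .{{_ : ℕ.NonZero n}} {t} → ¬ TwinIndex n → 0ℚ < t →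
                ⅕ * (fromℕ n * t) ≤ det (A n) * (fromℕ n * fromℕ n * t)
det-nonTwin-* n {t} ¬tw 0<t = subst (_≤ det (A n) * (N * N * t)) eq
  (*-monoʳ-≤-nonNeg (N * N * t) {{nonNegative (<⇒≤ (*-pos (*-pos 0<N 0<N) 0<t))}}
    (≤-trans (⁻¹-anti-≤ (<-≤-trans 0<1 (fromℕ-mono-≤ (ℕ.≤-trans (ℕ.s≤s ℕ.z≤n) (ℕ.m≤n+m 3 (2 ℕ.* n)))))
               (subst (fromℕ (2 ℕ.* n ℕ.+ 3) ≤_) (fromℕ-* 5 n) (fromℕ-mono-≤ (2n+3≤5n n))))
      (det-nonTwin n ¬tw)))
  where
  open +-*-Solver
  N w : ℚ
  N = fromℕ n
  w = (fromℕ 5 * N) ⁻¹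
  0<N = <-≤-trans 0<1 (1≤fromℕ n)
  eq : w * (N * N * t) ≡ ⅕ * (N * t)
  eq = trans (solve 3 (λ w N t → w :* (N :* N :* t) := con ⅕ :* (N :* t) :* (con (fromℕ 5) :* N :* w)) refl w N t)
       (trans (cong (⅕ * (N * t) *_) (⁻¹-inverseʳ (*-pos (toWitness {a? = 0ℚ <? fromℕ 5} _) 0<N)))
              (*-identityʳ (⅕ * (N * t))))

½^*2^ : ∀ j → ½ ^ j * fromℕ 2 ^ j ≡ 1ℚ
½^*2^ j = trans (sym (^-distrib-* ½ (fromℕ 2) j)) (1^ j)

-- Take t = 2^j and G = t^d ≤ n, where d is the denominator of r. Then n^s ≥ n² t, so the
-- denominator of the term is at least G t / 5. The factor t is the gain over 1/G that makes the
-- block sums decay geometrically.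
nonTwin-U : ∀ s n .{{_ : ℕ.NonZero n}} {r} j → L s r → fromℕ 2 < r → ¬ TwinIndex n →
            (2 ℕ.^ ↧ₙ r) ℕ.^ j ℕ.≤ n →
            U (term s n) (fromℕ 6 * (½ ^ j * fromℕ ((2 ℕ.^ ↧ₙ r) ℕ.^ j) ⁻¹))
nonTwin-U s n {r} j Lr 2<r ¬tw G≤n = term-U s n 0<z
    (≤-trans (*-monoˡ-≤-nonNeg ⅕ (*-monoʳ-≤-nonNeg t {{nonNegative (<⇒≤ 0<t)}} (fromℕ-mono-≤ G≤n)))
             (det-nonTwin-* n ¬tw 0<t))
    (λ {b} → U-pow-≥ s n {b = b} Lr
      (belowPow-> n 2<r 0<t (subst (_≤ fromℕ n) t^d≡G (fromℕ-mono-≤ G≤n))))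
    z⁻¹<c
  where
  open +-*-Solver
  d = ↧ₙ r
  G t h i : ℚ
  G = fromℕ ((2 ℕ.^ d) ℕ.^ j)
  t = fromℕ 2 ^ j
  h = ½ ^ j
  i = G ⁻¹
  0<G : 0ℚ < G
  0<G = <-≤-trans 0<1 (1≤fromℕ ((2 ℕ.^ d) ℕ.^ j) {{ℕ.m^n≢0 (2 ℕ.^ d) j {{ℕ.m^n≢0 2 d}}}})
  0<t = ^-pos (toWitness {a? = 0ℚ <? fromℕ 2} _) j
  0<z : 0ℚ < ⅕ * (G * t)
  0<z = *-pos (toWitness {a? = 0ℚ <? ⅕} _) (*-pos 0<G 0<t)
  t^d≡G : G ≡ t ^ d
  t^d≡G = trans (fromℕ-^ (2 ℕ.^ d) j) (trans (cong (_^ j) (fromℕ-^ 2 d))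
    (trans (^-assocʳ (fromℕ 2) d j) (trans (cong (fromℕ 2 ^_) (ℕ.*-comm d j))
      (sym (^-assocʳ (fromℕ 2) j d)))))
  z⁻¹ : fromℕ 5 * (h * i) ≡ (⅕ * (G * t)) ⁻¹
  z⁻¹ = ⁻¹-unique 0<z
    (trans (solve 4 (λ G t h i → con ⅕ :* (G :* t) :* (con (fromℕ 5) :* (h :* i)) := (h :* t) :* (G :* i))
              refl G t h i)
           (cong₂ _*_ (½^*2^ j) (⁻¹-inverseʳ 0<G)))
  -- The reciprocal itself carries the constant 5; enlarging it to 6 gives the strict inequality
  -- that the upper cut demands.
  z⁻¹<c : (⅕ * (G * t)) ⁻¹ < fromℕ 6 * (h * i)
  z⁻¹<c = subst (_< fromℕ 6 * (h * i)) z⁻¹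
    (*-monoˡ-<-pos (h * i) {{positive (*-pos (^-pos 0<½ j) (⁻¹-pos 0<G))}}
      (toWitness {a? = fromℕ 5 <? fromℕ 6} _))

-- Increasing sequences of reals and their limits.

L-lower-≤ : ∀ x {p q} → p ≤ q → L x q → L x p
L-lower-≤ x p≤q Lq = let r , q<r , Lr = L-open x Lq in L-lower x (≤-<-trans p≤q q<r) Lr

+ᴿ-comm-L : ∀ x y {q} → L (x +ᴿ y) q → L (y +ᴿ x) q
+ᴿ-comm-L x y {q} (a , b , La , Lb , q<a+b) = b , a , Lb , La , subst (q <_) (+-comm a b) q<a+b

-- `+ᴿ-L` does not apply, as c is not in its own open lower cut. Openness of the lower cut of y
-- gives room above a, which makes up for replacing c by a slightly smaller rational.
fromℚ-+ᴿ-L : ∀ c y {a} → L y a → L (fromℚ c +ᴿ y) (c + a)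
fromℚ-+ᴿ-L c y {a} La =
  let a′ , a<a′ , La′ = L-open y La ; m , a<m , m<a′ = <-dense a<a′ in
  c - (a′ - m) , a′ ,
  lin< m<a′ (solve 3 (λ c a m → c :- (a :- m) :+ a := c :+ m) refl c a′ m) , La′ ,
  lin< a<m (solve 4 (λ c a a′ m → c :+ a :+ m := c :- (a′ :- m) :+ a′ :+ a) refl c a a′ m)
  where open +-*-Solver

fromℚ-+ᴿ-U : ∀ c y {a} → U y a → U (fromℚ c +ᴿ y) (c + a)
fromℚ-+ᴿ-U c y {a} Ua =
  let a′ , a′<a , Ua′ = U-open y Ua ; m , a′<m , m<a = <-dense a′<a in
  c + (m - a′) , a′ ,
  lin< a′<m (solve 3 (λ c a m → c :+ m := c :+ (m :- a) :+ a) refl c a′ m) , Ua′ ,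
  lin< m<a (solve 4 (λ c a a′ m → c :+ (m :- a′) :+ a′ :+ a := c :+ a :+ m) refl c a a′ m)
  where open +-*-Solver

-- B j serves as a bound for the tail beyond g j: `step` says that x (g j) + B j does not increase
-- with j. The limit is squeezed between the increasing x k and these upper bounds, and B tending to
-- 0 makes the cut located.
module MonotoneLimit
  (x : ℕ → ℝ) (g : ℕ → ℕ) (B : ℕ → ℚ)
  (increasing : ∀ k {q} → L (x k) q → L (x (suc k)) q)
  (k≤g : ∀ k → k ℕ.≤ g k)
  (0≤B : ∀ j → 0ℚ ≤ B j)
  (B-small : ∀ {ε} → 0ℚ < ε → ∃ λ j → B j < ε)
  (step : ∀ j q → U (x (g j)) (q - B j) → U (x (g (suc j))) (q - B (suc j)))
  where

  open +-*-Solver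

  L-mono : ∀ {j k q} → j ℕ.≤ k → L (x j) q → L (x k) q
  L-mono j≤k = go (ℕ.≤⇒≤′ j≤k)
    where
    go : ∀ {j k q} → j ℕ.≤′ k → L (x j) q → L (x k) q
    go (ℕ.≤′-reflexive refl) Lq = Lq
    go (ℕ.≤′-step {k} le)    Lq = increasing k (go le Lq)

  U-mono : ∀ {j k} q → j ℕ.≤ k → U (x (g j)) (q - B j) → U (x (g k)) (q - B k)
  U-mono q j≤k = go (ℕ.≤⇒≤′ j≤k)
    where
    go : ∀ {j k} → j ℕ.≤′ k → U (x (g j)) (q - B j) → U (x (g k)) (q - B k)
    go (ℕ.≤′-reflexive refl) Uq = Uq
    go (ℕ.≤′-step {k} le)    Uq = step k q (go le Uq)

  limit : ℝ
  limit = record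
    { L = λ q → ∃ λ k → L (x k) q
    ; U = λ q → ∃ λ j → U (x (g j)) (q - B j)
    ; L-inhabited = let q , Lq = L-inhabited (x 0) in q , 0 , Lq
    ; U-inhabited = let q , Uq = U-inhabited (x (g 0)) in
        q + B 0 , 0 , subst (U (x (g 0))) (solve 2 (λ q b → q := q :+ b :- b) refl q (B 0)) Uq
    ; L-lower = λ { p<q (k , Lq) → k , L-lower (x k) p<q Lq }
    ; U-upper = λ { p<q (j , Up) → j , U-upper (x (g j)) (+-monoˡ-< (- B j) p<q) Up }
    ; L-open = λ { (k , Lp) → let q , p<q , Lq = L-open (x k) Lp in q , p<q , k , Lq }
    ; U-open = λ { {q} (j , Uq) → let p , p<q-B , Up = U-open (x (g j)) Uq in
        p + B j ,
        lin< p<q-B (solve 3 (λ p q b → p :+ b :+ (q :- b) := q :+ p) refl p q (B j)) ,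
        j , subst (U (x (g j))) (solve 2 (λ p b → p := p :+ b :- b) refl p (B j)) Up }
    -- Both facts are moved to the single real x (g i), using k ≤ i ≤ g i for the lower one.
    ; disjoint = λ { {q} (k , Lq) (j , Uq) → let i = k ℕ.⊔ j in
        disjoint (x (g i)) (L-mono (ℕ.≤-trans (ℕ.m≤m⊔n k j) (k≤g i)) Lq)
          (U-upper-≤ (x (g i)) (lin≤ {x = q - B i} {q} (0≤B i) (solve 2 (λ q b → q :- b :+ b := q :+ con 0ℚ) refl q (B i)))
            (U-mono q (ℕ.m≤n⊔m k j) Uq)) }
    ; located = loc
    }
    where
    -- Once B j < q - p, locating x (g j) between p and q - B j settles the matter.
    loc : ∀ {p q} → p < q → (∃ λ k → L (x k) p) ⊎ (∃ λ j → U (x (g j)) (q - B j))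
    loc {p} {q} p<q = let j , B<q-p = B-small (p<q⇒0<q-p p<q) in
      split j (located (x (g j))
        (lin< B<q-p (solve 3 (λ p q b → p :+ (q :- p) := q :- b :+ b) refl p q (B j))))
      where
      split : ∀ j → L (x (g j)) p ⊎ U (x (g j)) (q - B j) →
              (∃ λ k → L (x k) p) ⊎ (∃ λ j → U (x (g j)) (q - B j))
      split j (inj₁ Lp) = inj₁ (g j , Lp)
      split j (inj₂ Uq) = inj₂ (j , Uq)

  -- Half of ε goes to approximating x (g j) by a rational a, the other half absorbs B j;
  -- monotonicity keeps a below all later x k.
  eventually-close : ∀ {ε} → 0ℚ < ε → ∃ λ K → ∀ k → K ℕ.≤ k → ∃ λ a → L (x k) a × U limit (a + ε)
  eventually-close {ε} 0<ε =
    let j , B<ε½ = B-small (*-pos 0<ε 0<½) ; a , La , Ua = approx (x (g j)) (*-pos 0<ε 0<½) in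
    g j , λ k gj≤k → a , L-mono gj≤k La , j , U-upper (x (g j)) (lin< B<ε½
      (solve 3 (λ a e b → a :+ e :* con ½ :+ e :* con ½ := a :+ e :- b :+ b) refl a ε (B j))) Ua

-- The series over non-twin indices.

-- The decision is an explicit argument, so proofs can split on an arbitrary decision in a local
-- `go`.
unless : {P : Set} → Dec P → ℝ → ℝ
unless (yes _) _ = 0ᴿ
unless (no _)  x = x

nonTwinTerm : ℝ → (n : ℕ) .{{_ : ℕ.NonZero n}} → ℝ
nonTwinTerm s n = unless (twinIndex? n) (term s n)

nonTwinTerm-nonNeg : ∀ s n .{{_ : ℕ.NonZero n}} → NonNegᴿ (nonTwinTerm s n)
nonTwinTerm-nonNeg s n {b} b<0 = go (twinIndex? n)
  where
  go : (d : Dec (TwinIndex n)) → L (unless d (term s n)) b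
  go (yes _) = b<0
  go (no _)  = L-lower (term s n) {b} {0ℚ} b<0 (term-pos s n)

nonTwinTerm-pos : ∀ s n .{{_ : ℕ.NonZero n}} → ¬ TwinIndex n → L (nonTwinTerm s n) 0ℚ
nonTwinTerm-pos s n ¬tw = go (twinIndex? n)
  where
  go : (d : Dec (TwinIndex n)) → L (unless d (term s n)) 0ℚ
  go (yes tw) = ⊥-elim (¬tw tw)
  go (no _)   = term-pos s n

partialSum-nonNeg : ∀ a → (∀ n → NonNegᴿ (a (suc n))) → ∀ k → NonNegᴿ (partialSum a k)
partialSum-nonNeg a 0≤a zero    b<0 = b<0
partialSum-nonNeg a 0≤a (suc k) b<0 =
  +ᴿ-nonNeg-L (partialSum a k) (a (suc k)) (0≤a k) (partialSum-nonNeg a 0≤a k b<0)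

partialSum-+-U : ∀ a g {p c} → (∀ n → g ℕ.≤ n → U (a (suc n)) c) → U (partialSum a g) p →
                 ∀ i → U (partialSum a (i ℕ.+ g)) (p + fromℕ i * c)
partialSum-+-U a g {p} {c} Uc Up zero = subst (U (partialSum a g))
  (sym (trans (cong (λ t → p + t) (*-zeroˡ c)) (+-identityʳ p))) Up
partialSum-+-U a g {p} {c} Uc Up (suc i) = subst (U (partialSum a (suc i ℕ.+ g)))
  (trans (solve 3 (λ p i c → p :+ i :* c :+ c := p :+ (con 1ℚ :+ i) :* c) refl p (fromℕ i) c)
         (cong (λ t → p + t * c) (sym (fromℕ-suc i))))
  (+ᴿ-U (partialSum a (i ℕ.+ g)) (a (suc (i ℕ.+ g)))
    (partialSum-+-U a g Uc Up i) (Uc (i ℕ.+ g) (ℕ.m≤n+m g i)))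
  where open +-*-Solver

n<m^n : ∀ m → 2 ℕ.≤ m → ∀ n → n ℕ.< m ℕ.^ n
n<m^n m 2≤m zero    = ℕ.s≤s ℕ.z≤n
n<m^n m 2≤m (suc n) = ℕ.≤-trans (ℕ.≤-trans (ℕ.+-mono-≤ (ℕ.≤-trans (ℕ.s≤s ℕ.z≤n) ih) ih)
    (ℕ.≤-reflexive (cong (m ℕ.^ n ℕ.+_) (sym (ℕ.+-identityʳ (m ℕ.^ n))))))
  (ℕ.*-monoˡ-≤ (m ℕ.^ n) 2≤m)
  where ih = n<m^n m 2≤m n

-- The tail is summed over the blocks (G j, G (j + 1)] with G j = (2 ^ d) ^ j: each of the at most
-- 2 ^ d * G j terms of a block is at most 6 / (2 ^ j * G j).
module NonTwinSum (s : ℝ) (2<s : fromℚ (fromℕ 2) <ᴿ s) where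

  open +-*-Solver

  private
    r = proj₁ 2<s
    2<r = proj₁ (proj₂ 2<s)
    Lr = proj₂ (proj₂ 2<s)

    D : ℕ
    D = 2 ℕ.^ ↧ₙ r

    2≤D : 2 ℕ.≤ D
    2≤D = ℕ.≤-trans (ℕ.≤-reflexive (sym (ℕ.*-identityʳ 2))) (ℕ.*-monoʳ-≤ 2 (ℕ.m^n>0 2 (ℚ.denominator-1 r)))

    G : ℕ → ℕ
    G j = D ℕ.^ j

    B c : ℕ → ℚ
    -- Block j sums to at most 6 D / 2^j, and the geometric tail of these bounds is twice the first;
    -- thus B j - B (j + 1) is exactly the bound for block j.
    B j = fromℕ 12 * fromℕ D * ½ ^ j
    c j = fromℕ 6 * (½ ^ j * fromℕ (G j) ⁻¹)

    0<fromℕ : ∀ n .{{_ : ℕ.NonZero n}} → 0ℚ < fromℕ n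
    0<fromℕ n = <-≤-trans 0<1 (1≤fromℕ n)

    D≢0 : ℕ.NonZero D
    D≢0 = ℕ.m^n≢0 2 (↧ₙ r)

    0<G : ∀ j → 0ℚ < fromℕ (G j)
    0<G j = 0<fromℕ (G j) {{ℕ.m^n≢0 D j {{D≢0}}}}

    0<12D : 0ℚ < fromℕ 12 * fromℕ D
    0<12D = *-pos (toWitness {a? = 0ℚ <? fromℕ 12} _) (0<fromℕ D {{D≢0}})

    0<c : ∀ j → 0ℚ < c j
    0<c j = *-pos (toWitness {a? = 0ℚ <? fromℕ 6} _) (*-pos (^-pos 0<½ j) (⁻¹-pos (0<G j)))

    B-small : ∀ {ε} → 0ℚ < ε → ∃ λ j → B j < ε
    B-small {ε} 0<ε =
      let e , 0<e , e<ε = <-dense 0<ε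
          M = fromℕ 12 * fromℕ D
          -- Comparing powers of 1/2 with powers of 1 gives M / 2^(m+1) ≤ e, and e < ε makes the
          -- result strict.
          m , le = powers-unbounded 0<½ (toWitness {a? = ½ <? 1ℚ} _) (M * e ⁻¹)
      in suc m , ≤-<-trans (subst₂ _≤_
          (trans (solve 4 (λ M i h e → M :* i :* h :* e := M :* i :* e :* h) refl M (e ⁻¹) (½ ^ suc m) e)
                 (cong (_* ½ ^ suc m) (*⁻¹* M 0<e)))
          (trans (cong (_* e) (1^ (suc m))) (*-identityˡ e))
          (*-monoʳ-≤-nonNeg e {{nonNegative (<⇒≤ 0<e)}} le)) e<ε

    τ : ℕ → ℝ
    τ = partialSum (nonTwinTerm s)

    nonTwinTerm-U : ∀ j n → G j ℕ.≤ n → U (nonTwinTerm s (suc n)) (c j)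
    nonTwinTerm-U j n G≤n = go (twinIndex? (suc n))
      where
      go : (d : Dec (TwinIndex (suc n))) → U (unless d (term s (suc n))) (c j)
      go (yes _)  = 0<c j
      go (no ¬tw) = nonTwin-U s (suc n) j Lr 2<r ¬tw (ℕ.m≤n⇒m≤1+n G≤n)

    block : ∀ j → fromℕ (G (suc j) ℕ.∸ G j) * c j ≤ fromℕ 6 * (fromℕ D * ½ ^ j)
    block j = ≤-trans
      (*-monoʳ-≤-nonNeg (c j) {{nonNegative (<⇒≤ (0<c j))}} (fromℕ-mono-≤ (ℕ.m∸n≤m (G (suc j)) (G j))))
      (≤-reflexive (trans (cong (_* c j) (fromℕ-* D (G j)))
        (trans (solve 4 (λ D G h i → D :* G :* (con (fromℕ 6) :* (h :* i))
                   := con (fromℕ 6) :* (D :* h) :* (G :* i))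
                 refl (fromℕ D) (fromℕ (G j)) (½ ^ j) (fromℕ (G j) ⁻¹))
        (trans (cong (fromℕ 6 * (fromℕ D * ½ ^ j) *_) (⁻¹-inverseʳ (0<G j)))
               (*-identityʳ (fromℕ 6 * (fromℕ D * ½ ^ j)))))))

    step : ∀ j q → U (τ (G j)) (q - B j) → U (τ (G (suc j))) (q - B (suc j))
    step j q Uq = U-upper-≤ (τ (G (suc j)))
      (lin≤ (block j) (solve 4 (λ q D h x →
          q :- con (fromℕ 12) :* D :* h :+ x :+ con (fromℕ 6) :* (D :* h)
            := q :- con (fromℕ 12) :* D :* (con ½ :* h) :+ x)
        refl q (fromℕ D) (½ ^ j) (fromℕ (G (suc j) ℕ.∸ G j) * c j)))
      (subst (λ k → U (τ k) (q - B j + fromℕ (G (suc j) ℕ.∸ G j) * c j))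
        (ℕ.m∸n+n≡m (ℕ.^-monoʳ-≤ D {{D≢0}} (ℕ.n≤1+n j)))
        (partialSum-+-U (nonTwinTerm s) (G j) {q - B j} {c j} (nonTwinTerm-U j) Uq (G (suc j) ℕ.∸ G j)))

  open MonotoneLimit τ G B
    (λ k Lq → +ᴿ-nonNeg-L (τ k) (nonTwinTerm s (suc k)) (nonTwinTerm-nonNeg s (suc k)) Lq)
    (λ k → ℕ.<⇒≤ (n<m^n D 2≤D k))
    (λ j → <⇒≤ (*-pos 0<12D (^-pos 0<½ j)))
    B-small step
    public using (limit; eventually-close)

  limit-L : ∀ k {q} → L (partialSum (nonTwinTerm s) k) q → L limit q
  limit-L k Lq = k , Lq

  -- Index 3 gives (7, 9), which is not a twin pair; its positive term already bounds the third
  -- partial sum from below.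
  limit-pos : 0ᴿ <ᴿ limit
  limit-pos =
    let e , 0<e , Le = L-open (nonTwinTerm s 3) (nonTwinTerm-pos s 3 ¬twin) in
    e , 0<e , limit-L 3 (+ᴿ-comm-L (nonTwinTerm s 3) (τ 2) (+ᴿ-nonNeg-L (nonTwinTerm s 3) (τ 2)
      (partialSum-nonNeg (nonTwinTerm s) (λ n → nonTwinTerm-nonNeg s (suc n)) 2) Le))
    where
    ¬twin : ¬ TwinIndex 3
    ¬twin (_ , 9-prime) = toWitnessFalse {a? = prime? 9} tt 9-prime

-- Enumerating and counting twin prime pairs.

-- Shifted by one, as the series starts at n = 1.
twinPair : ℕ → ℕ × ℕ
twinPair n = 2 ℕ.* suc n ℕ.+ 1 , 2 ℕ.* suc n ℕ.+ 3

-- Descending order puts the newest index at the head, so the count follows the recursion of the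
-- partial sums.
twinIndices : ℕ → List ℕ
twinIndices k = List.filter (twinIndex? ∘ suc) (downFrom k)

twinCount : ℕ → ℕ
twinCount k = List.length (twinIndices k)

even⊎odd : ∀ p → (∃ λ k → p ≡ k ℕ.* 2) ⊎ (∃ λ k → p ≡ 2 ℕ.* k ℕ.+ 1)
even⊎odd zero = inj₁ (0 , refl)
even⊎odd (suc p) with even⊎odd p
... | inj₁ (k , refl) = inj₂ (k , trans (cong suc (ℕ.*-comm k 2)) (ℕ.+-comm 1 (2 ℕ.* k)))
... | inj₂ (k , refl) = inj₁ (suc k , cong suc (trans (ℕ.+-comm (2 ℕ.* k) 1) (cong suc (ℕ.*-comm 2 k))))

-- An even p would be 2, making q = 4 composite; an odd p is not 1, so its index is at least 1.
twinPrimes⇒twinPair : ∀ {x} → TwinPrimes x → ∃ λ n → x ≡ twinPair n × TwinIndex (suc n)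
twinPrimes⇒twinPair {p , q} (refl , pp , pq) with even⊎odd p
... | inj₁ (k , e) with prime∣prime⇒≡ (toWitness {a? = prime? 2} tt) pp (divides k e)
...   | refl = ⊥-elim (toWitnessFalse {a? = prime? 4} tt pq)
twinPrimes⇒twinPair {p , q} (refl , pp , pq) | inj₂ (zero , refl) = ⊥-elim (¬prime[1] pp)
twinPrimes⇒twinPair {p , q} (refl , pp , pq) | inj₂ (suc n , refl) =
  n , cong (2 ℕ.* suc n ℕ.+ 1 ,_) e , pp , subst Prime e pq
  where e = ℕ.+-assoc (2 ℕ.* suc n) 1 2

twinPair-twinPrimes : ∀ n → TwinIndex (suc n) → TwinPrimes (twinPair n)
twinPair-twinPrimes n (pp , pq) = sym (ℕ.+-assoc (2 ℕ.* suc n) 1 2) , pp , pq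

-- The form of finiteness that connects both directions: convergence yields such a bound, and a
-- bound lets decidable search list all pairs.
BoundedTwinIndices : ℕ → Set
BoundedTwinIndices k = ∀ n → TwinIndex (suc n) → n ℕ.< k

twinPrimes-cardinality : ∀ k → BoundedTwinIndices k → HasCardinality TwinPrimes (twinCount k)
twinPrimes-cardinality k bounded =
  List.map twinPair (twinIndices k) ,
  map⁺ twinPair-injective (filter⁺ (twinIndex? ∘ suc) (downFrom⁺ k)) ,
  (λ x → mk⇔ to from) ,
  length-map twinPair (twinIndices k)
  where
  twinPair-injective : ∀ {m n} → twinPair m ≡ twinPair n → m ≡ n
  twinPair-injective {m} {n} e =
    ℕ.suc-injective (ℕ.*-cancelˡ-≡ (suc m) (suc n) 2 (ℕ.+-cancelʳ-≡ 1 _ _ (cong proj₁ e)))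
  to : ∀ {x} → x ∈ List.map twinPair (twinIndices k) → TwinPrimes x
  to i with ∈-map⁻ twinPair i
  ... | n , n∈ , refl = twinPair-twinPrimes n
    (proj₂ (∈-filter⁻ (twinIndex? ∘ suc) {xs = downFrom k} n∈))
  from : ∀ {x} → TwinPrimes x → x ∈ List.map twinPair (twinIndices k)
  from tw with twinPrimes⇒twinPair tw
  ... | n , refl , ti = ∈-map⁺ twinPair (∈-filter⁺ (twinIndex? ∘ suc) (∈-downFrom⁺ (bounded n ti)) ti)

-- Duplicate-free lists with the same members are permutations of each other.
cardinality-unique : ∀ {X : Set} {P : X → Set} {M N} → HasCardinality P M → HasCardinality P N → M ≡ N
cardinality-unique (xs , xs! , xs⇔ , refl) (ys , ys! , ys⇔ , refl) =
  ↭-length (∼bag⇒↭ (unique∧set⇒bag xs! ys! λ {x} →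
    mk⇔ (Equivalence.from (ys⇔ x) ∘ Equivalence.to (xs⇔ x))
        (Equivalence.from (xs⇔ x) ∘ Equivalence.to (ys⇔ x))))

proj₁-bounded : (xs : List (ℕ × ℕ)) → ∃ λ K → ∀ {x} → x ∈ xs → proj₁ x ℕ.≤ K
proj₁-bounded [] = 0 , λ ()
proj₁-bounded (x ∷ xs) = let K , ≤K = proj₁-bounded xs in
  proj₁ x ℕ.+ K ,
  λ { (here refl) → ℕ.m≤m+n (proj₁ x) K
    ; (there i)   → ℕ.≤-trans (≤K i) (ℕ.m≤n+m K (proj₁ x)) }

-- The first prime 2(n + 1) + 1 of a pair exceeds n, so bounding the listed primes bounds n.
cardinality⇒bounded : ∀ {N} → HasCardinality TwinPrimes N → ∃ BoundedTwinIndices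
cardinality⇒bounded (xs , _ , xs⇔ , _) = let K , ≤K = proj₁-bounded xs in
  K , λ n ti → ℕ.≤-trans (ℕ.≤-trans (ℕ.m≤m+n (suc n) (suc n ℕ.+ 0)) (ℕ.m≤m+n (2 ℕ.* suc n) 1))
                         (≤K (Equivalence.from (xs⇔ (twinPair n)) (twinPair-twinPrimes n ti)))

eventually-twinCount : ∀ {N} → HasCardinality TwinPrimes N → ∃ λ K → ∀ k → K ℕ.≤ k → twinCount k ≡ N
eventually-twinCount card = let K , bounded = cardinality⇒bounded card in
  K , λ k K≤k → cardinality-unique
    (twinPrimes-cardinality k (λ n ti → ℕ.<-≤-trans (bounded n ti) K≤k)) card

twinCount-twin : ∀ k → TwinIndex (suc k) → fromℕ (twinCount (suc k)) ≡ 1ℚ + fromℕ (twinCount k)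
twinCount-twin k ti = trans (cong (fromℕ ∘ List.length) (filter-accept (twinIndex? ∘ suc) {xs = downFrom k} ti))
                        (fromℕ-suc (twinCount k))

twinCount-nonTwin : ∀ k → ¬ TwinIndex (suc k) → twinCount (suc k) ≡ twinCount k
twinCount-nonTwin k ¬ti = cong List.length (filter-reject (twinIndex? ∘ suc) {xs = downFrom k} ¬ti)

-- Partial sums as twin count plus non-twin sum.

-- With its companion for upper cuts, this replaces an equation between reals: twin terms equal 1 on
-- one side and 0 on the other, and the count makes up the difference.
partialSum-split-L : ∀ s k {q} → L (partialSum (nonTwinTerm s) k) q →
                     L (partialSum (term s) k) (fromℕ (twinCount k) + q)
partialSum-split-L s zero {q} q<0 = subst (_< 0ℚ) (sym (+-identityˡ q)) q<0
partialSum-split-L s (suc k) {q} = go (twinIndex? (suc k))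
  where
  open +-*-Solver
  go : (d : Dec (TwinIndex (suc k))) → L (partialSum (nonTwinTerm s) k +ᴿ unless d (term s (suc k))) q →
       L (partialSum (term s) (suc k)) (fromℕ (twinCount (suc k)) + q)
  go (no ¬ti) (a , b , La , Lb , q<a+b) =
    fromℕ (twinCount k) + a , b , partialSum-split-L s k La , Lb ,
    subst₂ _<_ (cong (λ n → fromℕ n + q) (sym (twinCount-nonTwin k ¬ti)))
               (sym (+-assoc (fromℕ (twinCount k)) a b)) (+-monoʳ-< (fromℕ (twinCount k)) q<a+b)
  -- The omitted term accounts for b < 0; the actual term, equal to 1, accounts for 1 + b < 1.
  go (yes ti) (a , b , La , b<0 , q<a+b) =
    fromℕ (twinCount k) + a , 1ℚ + b , partialSum-split-L s k La ,
    term-twin-L s (suc k) ti (subst (1ℚ + b <_) (+-identityʳ 1ℚ) (+-monoʳ-< 1ℚ b<0)) ,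
    lin< q<a+b (trans (cong (λ t → t + q + (a + b)) (twinCount-twin k ti))
      (solve 4 (λ n q a b → con 1ℚ :+ n :+ q :+ (a :+ b) := n :+ a :+ (con 1ℚ :+ b) :+ q) refl (fromℕ (twinCount k)) q a b))

partialSum-split-U : ∀ s k {q} → U (partialSum (nonTwinTerm s) k) q →
                     U (partialSum (term s) k) (fromℕ (twinCount k) + q)
partialSum-split-U s zero {q} 0<q = subst (0ℚ <_) (sym (+-identityˡ q)) 0<q
partialSum-split-U s (suc k) {q} = go (twinIndex? (suc k))
  where
  open +-*-Solver
  go : (d : Dec (TwinIndex (suc k))) → U (partialSum (nonTwinTerm s) k +ᴿ unless d (term s (suc k))) q →
       U (partialSum (term s) (suc k)) (fromℕ (twinCount (suc k)) + q)
  go (no ¬ti) (a , b , Ua , Ub , a+b<q) =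
    fromℕ (twinCount k) + a , b , partialSum-split-U s k Ua , Ub ,
    subst₂ _<_ (sym (+-assoc (fromℕ (twinCount k)) a b))
               (cong (λ n → fromℕ n + q) (sym (twinCount-nonTwin k ¬ti))) (+-monoʳ-< (fromℕ (twinCount k)) a+b<q)
  go (yes ti) (a , b , Ua , 0<b , a+b<q) =
    fromℕ (twinCount k) + a , 1ℚ + b , partialSum-split-U s k Ua ,
    term-twin-U s (suc k) ti (subst (_< 1ℚ + b) (+-identityʳ 1ℚ) (+-monoʳ-< 1ℚ 0<b)) ,
    lin< a+b<q (trans
      (solve 4 (λ n q a b → n :+ a :+ (con 1ℚ :+ b) :+ q := con 1ℚ :+ n :+ q :+ (a :+ b)) refl (fromℕ (twinCount k)) q a b)
      (cong (λ t → t + q + (a + b)) (sym (twinCount-twin k ti))))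

-- Each twin index raises the partial sums by 1, while all late partial sums lie within 1/2 of each other.
converges⇒bounded : ∀ s ℓ → SeriesConvergesTo (term s) ℓ → ∃ BoundedTwinIndices
converges⇒bounded s ℓ conv = K , <K
  where
  open +-*-Solver
  0<¼ = *-pos 0<½ 0<½
  K = proj₁ (conv 0<¼)
  close = proj₂ (conv 0<¼)
  S = partialSum (term s)
  clash : ∀ n → TwinIndex (suc n) → S (suc n) <ᴿ ℓ +ᴿ fromℚ ¼ → ℓ <ᴿ S n +ᴿ fromℚ ¼ → ⊥
  clash n ti (q , Uq , c , d , Lc , d<¼ , q<c+d) (q′ , Uq′ , a , b , La , b<¼ , q′<a+b) =
    <-irrefl refl (<-trans (L<U (S (suc n)) {a + ½} {q} La+½ Uq) (<-trans q<c+d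
      (lin< (+-mono-< (L<U ℓ Lc Uq′) (+-mono-< q′<a+b (+-mono-< d<¼ b<¼)))
        (solve 5 (λ a b c d q → c :+ d :+ (q :+ (a :+ b :+ (con ¼ :+ con ¼)))
            := a :+ con ½ :+ (c :+ (q :+ (d :+ b)))) refl a b c d q′))))
    where
    La+½ : L (S (suc n)) (a + ½)
    La+½ = +ᴿ-L (S n) (term s (suc n)) La (term-twin-L s (suc n) ti (toWitness {a? = ½ <? 1ℚ} _))
  <K : BoundedTwinIndices K
  <K n ti with n ℕ.<? K
  ... | yes n<K = n<K
  ... | no  n≮K = ⊥-elim (clash n ti (proj₁ (close (suc n) (ℕ.m≤n⇒m≤1+n (ℕ.≮⇒≥ n≮K))))
                                     (proj₂ (close n (ℕ.≮⇒≥ n≮K))))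

-- The sum of the series when the twin pairs are finite in number.

module _ (s : ℝ) (2<s : fromℚ (fromℕ 2) <ᴿ s) where

  open NonTwinSum s 2<s
  open +-*-Solver

  -- Beyond both thresholds the count has settled at N and the non-twin sum is within ε/2 of its
  -- limit in the sense of `eventually-close`.
  convergesTo-N+limit : ∀ N → HasCardinality TwinPrimes N →
                        SeriesConvergesTo (term s) (fromℚ (fromℕ N) +ᴿ limit)
  convergesTo-N+limit N card {ε} 0<ε = K₁ ℕ.⊔ K₂ , λ k K≤k →
      go k (twinCount≡N k (ℕ.≤-trans (ℕ.m≤m⊔n K₁ K₂) K≤k)) (close k (ℕ.≤-trans (ℕ.m≤n⊔m K₁ K₂) K≤k))
    where
    0<ε½ = *-pos 0<ε 0<½
    K₁ = proj₁ (eventually-twinCount card)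
    twinCount≡N = proj₂ (eventually-twinCount card)
    K₂ = proj₁ (eventually-close 0<ε½)
    close = proj₂ (eventually-close 0<ε½)
    ν = fromℕ N
    S = partialSum (term s)
    τ = partialSum (nonTwinTerm s)

    half : ∀ a → ν + (a + ε * ½) ≤ ν + a + ε
    half a = lin≤ (<⇒≤ 0<ε½)
      (solve 3 (λ n a e → n :+ (a :+ e :* con ½) :+ e :* con ½ := n :+ a :+ e :+ con 0ℚ) refl ν a ε)

    +ε-L : ∀ x {a} → L x (ν + a) → L (x +ᴿ fromℚ ε) (ν + (a + ε * ½))
    +ε-L x {a} La = L-lower-≤ (x +ᴿ fromℚ ε) (half a) (+ᴿ-comm-L (fromℚ ε) x
      (subst (L (fromℚ ε +ᴿ x)) (+-comm ε (ν + a)) (fromℚ-+ᴿ-L ε x La)))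

    go : ∀ k → twinCount k ≡ N → (∃ λ a → L (τ k) a × U limit (a + ε * ½)) →
         (S k <ᴿ (fromℚ ν +ᴿ limit) +ᴿ fromℚ ε) × (fromℚ ν +ᴿ limit <ᴿ S k +ᴿ fromℚ ε)
    -- For the upper estimate, τ k is approximated anew from both sides: the rational above it
    -- bounds S k, and the one below it also lies below `limit`.
    go k refl (a , La , Ua) = upper (approx (τ k) 0<ε½) ,
      (ν + (a + ε * ½) , fromℚ-+ᴿ-U ν limit Ua , +ε-L (S k) (partialSum-split-L s k La))
      where
      upper : (∃ λ b → L (τ k) b × U (τ k) (b + ε * ½)) → S k <ᴿ (fromℚ ν +ᴿ limit) +ᴿ fromℚ ε
      upper (b , Lb , Ub) = ν + (b + ε * ½) , partialSum-split-U s k Ub ,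
        +ε-L (fromℚ ν +ᴿ limit) (fromℚ-+ᴿ-L ν limit (limit-L k Lb))

proposition3p1 : (s : ℝ) → fromℚ (fromℕ 2) <ᴿ s →
    ∃ λ (τ : ℝ) → 0ᴿ <ᴿ τ ×
    (SeriesConverges (term s) ⇔ FinitelyMany TwinPrimes) ×
    (∀ (N : ℕ) → HasCardinality TwinPrimes N →
    SeriesConvergesTo (term s) (fromℚ (fromℕ N) +ᴿ τ))
proposition3p1 s 2<s = limit , limit-pos , mk⇔ finite converges , convergesTo
  where
  open NonTwinSum s 2<s
  convergesTo = convergesTo-N+limit s 2<s
  finite : SeriesConverges (term s) → FinitelyMany TwinPrimes
  finite (ℓ , conv) = let K , bounded = converges⇒bounded s ℓ conv in
    twinCount K , twinPrimes-cardinality K bounded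
  converges : FinitelyMany TwinPrimes → SeriesConverges (term s)
  converges (N , card) = fromℚ (fromℕ N) +ᴿ limit , convergesTo N card
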